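{- Let $A$ be an infinite abelian group of finite exponent, viewed as a structure in the language $\mathcal L=\{0,+\}$. For each prime $p$ let $n_p:=|U_{\ge\aleph_0}(p;A)|$, and let $m_p:=\max U_{\ge\aleph_0}(p;A)$ if $U_{\ge\aleph_0}(p;A)\neq\emptyset$ and $m_p:=0$ otherwise. Set $d:=\sum_p\min\{n_p,\lfloor m_p/2\rfloor+1\}$. Then every $\mathcal L$-formula $\varphi(x;y)$ has VC density at most $d\,|y|$ in $A$.
   Context: For an abelian group $A$, a prime $p$ and $i\ge 0$, the Ulm invariant is $U(p,i;A):=|(p^iA)[p]/(p^{i+1}A)[p]|$, where $(p^iA)[p]=\{a\in A: pa=0 \text{ and } a=p^ib \text{ for some } b\in A\}$. $U_{\ge\aleph_0}(p;A)$ is the set of $i\ge 0$ with $U(p,i;A)$ infinite. For a partitioned formula $\varphi(x;y)$, the shatter function $\pi_\varphi(t)$ is the maximum, over $t$-element subsets $S\subseteq A^{|x|}$, of the number of sets of the form $S\cap\varphi(A^{|x|};b)$, $b\in A^{|y|}$; the VC density of $\varphi$ is $\inf\{r\ge0:\pi_\varphi(t)=O(t^r)\}$ (and $\infty$ if $\pi_\varphi(t)=2^t$ for all $t$). -}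

module Defs where

open import Level using (0ℓ)
open import Algebra.Bundles using (AbelianGroup)
open import Data.Nat as ℕ using (ℕ; zero; suc; _*_; _^_; _≤_; _<_; _⊓_; _/_)
open import Data.Nat.Primality using (Prime)
open import Data.Fin using (Fin)
open import Data.List using (List; length; map)
open import Data.List.Membership.Propositional using (_∈_; _∉_)
open import Data.List.Relation.Unary.Unique.Propositional using (Unique)
open import Data.Vec.Functional using (Vector; _++_)
open import Data.Product using (Σ; ∃; _×_; _,_)
open import Data.Sum using (_⊎_)
open import Data.Empty using (⊥)
open import Relation.Nullary using (¬_)
open import Relation.Binary.PropositionalEquality using (_≡_; _≢_)

LEM : Set₁
LEM = (P : Set) → P ⊎ ¬ P

_⇔_ : Set → Set → Set
P ⇔ Q = (P → Q) × (Q → P)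

data Term (n : ℕ) : Set where
  var  : Fin n → Term n
  `0   : Term n
  _⊕_  : Term n → Term n → Term n

data Formula : ℕ → Set where
  _≐_  : ∀ {n} → Term n → Term n → Formula n
  ¬'_  : ∀ {n} → Formula n → Formula n
  _∧'_ : ∀ {n} → Formula n → Formula n → Formula n
  ∃'_  : ∀ {n} → Formula (suc n) → Formula n

module _ (G : AbelianGroup 0ℓ 0ℓ) where
  open AbelianGroup G renaming (Carrier to A)

  ⟦_⟧ : ∀ {n} → Term n → Vector A n → A
  ⟦ var i ⟧ ρ = ρ i
  ⟦ `0 ⟧ ρ = ε
  ⟦ s ⊕ t ⟧ ρ = ⟦ s ⟧ ρ ∙ ⟦ t ⟧ ρ

  Sat : ∀ {n} → Formula n → Vector A n → Set
  Sat (s ≐ t) ρ = ⟦ s ⟧ ρ ≈ ⟦ t ⟧ ρ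
  Sat (¬' φ) ρ = ¬ Sat φ ρ
  Sat (φ ∧' ψ) ρ = Sat φ ρ × Sat ψ ρ
  Sat (∃' φ) ρ = Σ A (λ a → Sat φ (Data.Vec.Functional._∷_ a ρ))

  _·_ : ℕ → A → A
  zero · a = ε
  suc n · a = a ∙ (n · a)

  Infinite : Set
  Infinite = ∀ n → Σ (Fin n → A) λ f → ∀ i j → f i ≈ f j → i ≡ j

  FiniteExponent : Set
  FiniteExponent = Σ ℕ λ e → (1 ≤ e) × (∀ a → (e · a) ≈ ε)

  InPiAp : ℕ → ℕ → A → Set
  InPiAp p i a = ((p · a) ≈ ε) × Σ A (λ b → a ≈ ((p ^ i) · b))

  -- U(p,i;A) is infinite: for every n there are n elements of (p^iA)[p]
  -- pairwise distinct modulo the subgroup (p^{i+1}A)[p].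
  UInfinite : ℕ → ℕ → Set
  UInfinite p i = ∀ n → Σ (Fin n → A) λ f →
    (∀ j → InPiAp p i (f j)) ×
    (∀ j k → InPiAp p (suc i) (f j ∙ (f k ⁻¹)) → j ≡ k)

  IsNp : ℕ → ℕ → Set
  IsNp p np = Σ (List ℕ) λ L → Unique L × (length L ≡ np) × (∀ i → (i ∈ L) ⇔ UInfinite p i)

  IsMp : ℕ → ℕ → Set
  IsMp p mp = ((∀ i → ¬ UInfinite p i) × (mp ≡ 0))
            ⊎ (UInfinite p mp × (∀ i → UInfinite p i → i ≤ mp))

  dTerm : (ℕ → ℕ) → (ℕ → ℕ) → ℕ → ℕ
  dTerm np mp p = np p ⊓ (mp p / 2 ℕ.+ 1)

  SameTrace : ∀ {k l t} → Formula (k ℕ.+ l) → (Fin t → Vector A k) →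
              Vector A l → Vector A l → Set
  SameTrace φ S b b' = ∀ s → Sat φ (S s ++ b) ⇔ Sat φ (S s ++ b')

  -- "the number of traces of φ on S is < N"
  TracesBelow : ∀ {k l t} → Formula (k ℕ.+ l) → (Fin t → Vector A k) → ℕ → Set
  TracesBelow {l = l} φ S N = (b : Fin N → Vector A l) →
    Σ (Fin N) λ j → Σ (Fin N) λ j' → (j ≢ j') × SameTrace φ S (b j) (b j')

  Distinct : ∀ {k t} → (Fin t → Vector A k) → Set
  Distinct {t = t} S = ∀ i j → (∀ c → S i c ≈ S j c) → i ≡ j

  -- VC density of φ(x;y) is ≤ D, i.e. for every rational r = D + 1/q (q ≥ 1)
  -- π_φ(t) = O(t^r): ∃ C t₀, ∀ t ≥ t₀, every t-subset S has #traces ≤ C·t^r,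
  -- written in integers as (#traces)^q ≤ C·t^(D·q+1).
  VCDensity≤ : ∀ k l → Formula (k ℕ.+ l) → ℕ → Set
  VCDensity≤ k l φ D = ∀ q → 1 ≤ q → Σ ℕ λ C → Σ ℕ λ t₀ →
    ∀ t → t₀ ≤ t → (S : Fin t → Vector A k) → Distinct S →
    ∀ N → C * t ^ (D * q ℕ.+ 1) < N ^ q → TracesBelow φ S N

{-# OPTIONS --safe #-}
module Submission where

-- Let e be the exponent and call "pʲ ∣ c·ρ" (p prime, c an integer vector) a divisibility condition.
--
-- A back-and-forth argument in the style of Ulm's theorem shows that tuples satisfying the same
-- divisibility conditions satisfy the same formulas: to match an element added to ρ by one added
-- to σ, one adjoins elements a with pa ∈ ⟨ρ⟩ one at a time, and the only obstruction, a new element of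
-- (pʰA)[p] modulo pʰ⁺¹A, is overcome by counting.
--
-- Hence the trace of b on S is determined by the cosets of the subgroups {y : pʲ ∣ c·y} of Aˡ in
-- which b lies, out of O(t) cosets for each of finitely many subgroups. It remains to see that,
-- among any such subgroups at p, some min(n_p, ⌊m_p/2⌋+1)·l already have, up to finite index, the
-- intersection of all. For l = 1 the subgroups are {x : pʲ ∣ pⁱx}; up to finite index they are
-- described by the exponents min(j-i, n-i) on those cyclic summands Z(pⁿ) that occur infinitely often,
-- i.e. U(p, n-1) is infinite. One may keep the best subgroup for each n, or the best one for each
-- value of r = min(i, j-i-1): these subgroups form a chain, and 2r ≤ m_p. For l > 1 one eliminates a variable from pairs of conditions.

open import Defs
open import Level using (0ℓ)
open import Algebra.Bundles using (AbelianGroup)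
import Algebra.Properties.AbelianGroup as AbelianGroupProperties
import Algebra.Properties.CommutativeMonoid.Mult as Mult
import Algebra.Properties.Group as GroupProperties
import Data.Nat as ℕ
open import Data.Nat using (ℕ; zero; suc; _*_; _^_; _≤_; _<_; _∸_; _⊓_; _⊔_; _/_; _%_; z≤n; s≤s; NonZero)
import Data.Nat.Properties as ℕₚ
open import Data.Nat.Coprimality using (Coprime; coprime-divisor; coprime-Bézout)
open import Data.Nat.Divisibility using (_∣_; divides; _∣?_; ∣-trans; ∣1⇒≡1; ∣⇒≤)
open import Data.Nat.DivMod using (m≡m%n+[m/n]*n; m%n<n; /-monoˡ-≤; m*n/n≡m)
open import Data.Nat.GCD using (module Bézout)
open import Data.Nat.Induction using (<-rec)
open import Data.Nat.Primality using (Prime; prime?; prime⇒nonZero; prime⇒nonTrivial; prime⇒irreducible; ¬prime[1]; euclidsLemma)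
open import Data.Nat.Primality.Factorisation using (PrimeFactorisation; factorise)
open import Data.Fin as Fin using (Fin; zero; suc)
import Data.Fin.Properties as Finₚ
open import Data.List using (List; []; _∷_; length; map; upTo; _++_; cartesianProduct; cartesianProductWith; filter; lookup)
import Data.List.Properties as Listₚ
open import Data.Nat.ListAction using (sum; product)
open import Data.Nat.ListAction.Properties using (sum-++)
open import Data.List.Membership.Propositional using (_∈_; _∉_)
open import Data.List.Membership.DecPropositional ℕ._≟_ using (_∈?_)
open import Data.List.Membership.Propositional.Properties
open import Data.List.Relation.Unary.All using (All; []; _∷_)
open import Data.List.Relation.Unary.Any using (here; there; index)
open import Data.List.Relation.Unary.Any.Properties using (lookup-index)
open import Data.List.Relation.Unary.Unique.Propositional using (Unique)
open import Data.Vec as Vec using (Vec; []; _∷_)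
open import Data.Vec.Functional as F using (Vector)
open import Data.Product using (Σ; _×_; _,_; proj₁; proj₂)
open import Data.Sum using (_⊎_; inj₁; inj₂; [_,_]′)
open import Data.Sum.Properties using (inj₁-injective; inj₂-injective)
open import Data.Unit using (⊤; tt)
open import Data.Empty using (⊥; ⊥-elim)
open import Function using (_∘_)
open import Relation.Nullary using (¬_; Dec; yes; no; ¬?)
open import Relation.Nullary.Decidable using (_×-dec_)
open import Relation.Binary.PropositionalEquality using (_≡_; _≢_; refl)
import Relation.Binary.PropositionalEquality as ≡

-- Arithmetic of prime powers.

valuation : ∀ {p} → Prime p → ∀ n → 1 ≤ n → Σ ℕ λ i → Σ ℕ λ u → (n ≡ p ^ i * u) × ¬ (p ∣ u)
valuation {p} pp = <-rec _ step
  where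
  step : ∀ n → (∀ {m} → m < n → 1 ≤ m → Σ ℕ λ i → Σ ℕ λ u → (m ≡ p ^ i * u) × ¬ (p ∣ u)) →
         1 ≤ n → Σ ℕ λ i → Σ ℕ λ u → (n ≡ p ^ i * u) × ¬ (p ∣ u)
  step n rec n≥1 with p ∣? n
  ... | no p∤n = 0 , n , ≡.sym (ℕₚ.+-identityʳ n) , p∤n
  ... | yes (divides zero refl) with () ← n≥1
  ... | yes (divides (suc q) refl)
    with rec (ℕₚ.m<m*n (suc q) p (ℕ.nonTrivial⇒n>1 p {{prime⇒nonTrivial pp}})) (s≤s z≤n)
  ... | i , u , q≡ , p∤u = suc i , u , (begin
      suc q * p       ≡⟨ ≡.cong (_* p) q≡ ⟩
      p ^ i * u * p   ≡⟨ ℕₚ.*-comm (p ^ i * u) p ⟩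
      p * (p ^ i * u) ≡⟨ ℕₚ.*-assoc p (p ^ i) u ⟨
      p ^ suc i * u   ∎) , p∤u
    where open ≡.≡-Reasoning

coprime-prime-power : ∀ {p u} → Prime p → ¬ (p ∣ u) → ∀ j → Coprime u (p ^ j)
coprime-prime-power pp p∤u zero (_ , d∣1) = ∣1⇒≡1 d∣1
coprime-prime-power {p} {u} pp p∤u (suc j) {d} (d∣u , d∣pʲ⁺¹) =
  coprime-prime-power pp p∤u j (d∣u , coprime-divisor d⊥p d∣pʲ⁺¹)
  where
  d⊥p : Coprime d p
  d⊥p (x∣d , x∣p) with prime⇒irreducible pp x∣p
  ... | inj₁ x≡1 = x≡1
  ... | inj₂ refl = ⊥-elim (p∤u (∣-trans x∣d d∣u))

n≤p^n : ∀ {p} → Prime p → ∀ n → n ≤ p ^ n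
n≤p^n pp zero = z≤n
n≤p^n {p} pp (suc n) = begin
  suc n             ≤⟨ s≤s (n≤p^n pp n) ⟩
  1 ℕ.+ p ^ n       ≤⟨ ℕₚ.+-monoˡ-≤ (p ^ n) (ℕₚ.m^n>0 p {{prime⇒nonZero pp}} n) ⟩
  p ^ n ℕ.+ p ^ n   ≡⟨ ≡.cong (p ^ n ℕ.+_) (ℕₚ.+-identityʳ (p ^ n)) ⟨
  2 * p ^ n         ≤⟨ ℕₚ.*-monoˡ-≤ (p ^ n) (ℕ.nonTrivial⇒n>1 p {{prime⇒nonTrivial pp}}) ⟩
  p * p ^ n         ∎
  where open ℕₚ.≤-Reasoning

-- Multiples, integer linear forms and divisibility in abelian groups.

module GroupLemmas (G : AbelianGroup 0ℓ 0ℓ) where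
  open AbelianGroup G renaming (Carrier to A; sym to ≈-sym; trans to ≈-trans; refl to ≈-refl; reflexive to ≈-reflexive)
  open AbelianGroupProperties G using (⁻¹-∙-comm)
  open GroupProperties group using (inverseʳ-unique; ε⁻¹≈ε; x∙y⁻¹≈ε⇒x≈y; ⁻¹-anti-homo-//)
  open import Relation.Binary.Reasoning.Setoid setoid
  module × = Mult commutativeMonoid

  infixr 7.5 _⋆_
  _⋆_ : ℕ → A → A
  _⋆_ = _·_ G

  ⋆≈× : ∀ n x → n ⋆ x ≈ n ×.× x
  ⋆≈× zero x = ≈-refl
  ⋆≈× (suc n) x = ∙-congˡ (⋆≈× n x)

  ⋆-cong : ∀ n {x y} → x ≈ y → n ⋆ x ≈ n ⋆ y
  ⋆-cong zero x≈y = ≈-refl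
  ⋆-cong (suc n) x≈y = ∙-cong x≈y (⋆-cong n x≈y)

  ⋆-congˡ : ∀ {m n x} → m ≡ n → m ⋆ x ≈ n ⋆ x
  ⋆-congˡ refl = ≈-refl

  ⋆-+ : ∀ m n x → (m ℕ.+ n) ⋆ x ≈ m ⋆ x ∙ n ⋆ x
  ⋆-+ m n x = ≈-trans (⋆≈× (m ℕ.+ n) x)
    (≈-trans (×.×-homo-+ x m n) (≈-sym (∙-cong (⋆≈× m x) (⋆≈× n x))))

  ⋆-* : ∀ m n x → (m * n) ⋆ x ≈ m ⋆ n ⋆ x
  ⋆-* m n x = ≈-trans (⋆≈× (m * n) x) (≈-trans (≈-sym (×.×-assocˡ x m n))
    (≈-sym (≈-trans (⋆-cong m (⋆≈× n x)) (⋆≈× m (n ×.× x)))))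

  ⋆-comm : ∀ m n x → m ⋆ n ⋆ x ≈ n ⋆ m ⋆ x
  ⋆-comm m n x = ≈-trans (≈-sym (⋆-* m n x))
    (≈-trans (⋆-congˡ (ℕₚ.*-comm m n)) (⋆-* n m x))

  ⋆-∙ : ∀ n x y → n ⋆ (x ∙ y) ≈ n ⋆ x ∙ n ⋆ y
  ⋆-∙ n x y = ≈-trans (⋆≈× n (x ∙ y))
    (≈-trans (×.×-distrib-+ x y n) (≈-sym (∙-cong (⋆≈× n x) (⋆≈× n y))))

  ⋆-ε : ∀ n → n ⋆ ε ≈ ε
  ⋆-ε zero = ≈-refl
  ⋆-ε (suc n) = ≈-trans (identityˡ _) (⋆-ε n)

  ⋆-⁻¹ : ∀ n x → n ⋆ x ⁻¹ ≈ (n ⋆ x) ⁻¹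
  ⋆-⁻¹ n x = inverseʳ-unique _ _ (≈-trans (≈-sym (⋆-∙ n x (x ⁻¹)))
    (≈-trans (⋆-cong n (inverseʳ x)) (⋆-ε n)))

  ⋆-sub : ∀ n x y → n ⋆ (x - y) ≈ n ⋆ x - n ⋆ y
  ⋆-sub n x y = ≈-trans (⋆-∙ n x (y ⁻¹)) (∙-congˡ (⋆-⁻¹ n y))

  1⋆ : ∀ x → 1 ⋆ x ≈ x
  1⋆ x = identityʳ x

  -‿cong : ∀ {w x y z} → w ≈ x → y ≈ z → w - y ≈ x - z
  -‿cong p q = ∙-cong p (⁻¹-cong q)

  -- Natural coefficients suffice: in exponent `e`, multiplication by `e-1` is negation.
  dot : ∀ {n} → Vec ℕ n → Vector A n → A
  dot [] ρ = ε
  dot (k ∷ c) ρ = k ⋆ ρ zero ∙ dot c (ρ ∘ suc)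

  infixl 6 _⊹_
  _⊹_ : ∀ {n} → Vec ℕ n → Vec ℕ n → Vec ℕ n
  _⊹_ = Vec.zipWith ℕ._+_

  ∙-interchange : ∀ a b c d → (a ∙ b) ∙ (c ∙ d) ≈ (a ∙ c) ∙ (b ∙ d)
  ∙-interchange a b c d = begin
    (a ∙ b) ∙ (c ∙ d) ≈⟨ assoc a b (c ∙ d) ⟩
    a ∙ (b ∙ (c ∙ d)) ≈⟨ ∙-congˡ (≈-sym (assoc b c d)) ⟩
    a ∙ ((b ∙ c) ∙ d) ≈⟨ ∙-congˡ (∙-congʳ (comm b c)) ⟩
    a ∙ ((c ∙ b) ∙ d) ≈⟨ ∙-congˡ (assoc c b d) ⟩
    a ∙ (c ∙ (b ∙ d)) ≈⟨ assoc a c (b ∙ d) ⟨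
    (a ∙ c) ∙ (b ∙ d) ∎

  dot-⊹ : ∀ {n} (c d : Vec ℕ n) ρ → dot (c ⊹ d) ρ ≈ dot c ρ ∙ dot d ρ
  dot-⊹ [] [] ρ = ≈-sym (identityˡ ε)
  dot-⊹ (k ∷ c) (l ∷ d) ρ =
    ≈-trans (∙-cong (⋆-+ k l _) (dot-⊹ c d _)) (∙-interchange _ _ _ _)

  dot-cong : ∀ {n} (c : Vec ℕ n) {ρ σ : Vector A n} → (∀ i → ρ i ≈ σ i) → dot c ρ ≈ dot c σ
  dot-cong [] eq = ≈-refl
  dot-cong (k ∷ c) eq = ∙-cong (⋆-cong k (eq zero)) (dot-cong c (eq ∘ suc))

  dot-replicate-0 : ∀ {n} (ρ : Vector A n) → dot (Vec.replicate n 0) ρ ≈ ε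
  dot-replicate-0 {zero} ρ = ≈-refl
  dot-replicate-0 {suc n} ρ = ≈-trans (identityˡ _) (dot-replicate-0 (ρ ∘ suc))

  dot-map-* : ∀ {n} k (c : Vec ℕ n) ρ → dot (Vec.map (k *_) c) ρ ≈ k ⋆ dot c ρ
  dot-map-* k [] ρ = ≈-sym (⋆-ε k)
  dot-map-* k (l ∷ c) ρ =
    ≈-trans (∙-cong (⋆-* k l _) (dot-map-* k c _)) (≈-sym (⋆-∙ k _ _))

  unit : ∀ {n} → Fin n → Vec ℕ n
  unit zero = 1 ∷ Vec.replicate _ 0
  unit (suc i) = 0 ∷ unit i

  dot-unit : ∀ {n} (i : Fin n) ρ → dot (unit i) ρ ≈ ρ i
  dot-unit zero ρ = ≈-trans (∙-cong (1⋆ _) (dot-replicate-0 (ρ ∘ suc))) (identityʳ _)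
  dot-unit (suc i) ρ = ≈-trans (identityˡ _) (dot-unit i (ρ ∘ suc))

  infixl 6 _⊖_
  _⊖_ : ∀ {n} → Vector A n → Vector A n → Vector A n
  (u ⊖ v) i = u i - v i

  -‿interchange : ∀ a b c d → (a ∙ b) - (c ∙ d) ≈ (a - c) ∙ (b - d)
  -‿interchange a b c d = ≈-trans (∙-congˡ (≈-sym (⁻¹-∙-comm c d))) (∙-interchange a b (c ⁻¹) (d ⁻¹))

  dot-⊖ : ∀ {n} (c : Vec ℕ n) u v → dot c (u ⊖ v) ≈ dot c u - dot c v
  dot-⊖ [] u v = ≈-sym (inverseʳ ε)
  dot-⊖ (k ∷ c) u v =
    ≈-trans (∙-cong (⋆-sub k _ _) (dot-⊖ c _ _)) (≈-sym (-‿interchange _ _ _ _))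

  -- Equations in abelian groups are decided by comparing coefficients, kept as a
  -- positive and a negative part so that dot can evaluate them.
  infixl 6 _:+_ _:-_
  infix 7 :-_
  data Expr (n : ℕ) : Set where
    atom : Fin n → Expr n
    :0   : Expr n
    _:+_ : Expr n → Expr n → Expr n
    :-_  : Expr n → Expr n

  _:-_ : ∀ {n} → Expr n → Expr n → Expr n
  s :- t = s :+ :- t

  v₀ : ∀ {n} → Expr (1 ℕ.+ n)
  v₀ = atom zero
  v₁ : ∀ {n} → Expr (2 ℕ.+ n)
  v₁ = atom (suc zero)
  v₂ : ∀ {n} → Expr (3 ℕ.+ n)
  v₂ = atom (suc (suc zero))
  v₃ : ∀ {n} → Expr (4 ℕ.+ n)
  v₃ = atom (suc (suc (suc zero)))

  eval : ∀ {n} → Expr n → Vector A n → A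
  eval (atom i) ρ = ρ i
  eval :0 ρ = ε
  eval (s :+ t) ρ = eval s ρ ∙ eval t ρ
  eval (:- t) ρ = eval t ρ ⁻¹

  pos neg : ∀ {n} → Expr n → Vec ℕ n
  pos (atom i) = unit i
  pos :0 = Vec.replicate _ 0
  pos (s :+ t) = pos s ⊹ pos t
  pos (:- t) = neg t
  neg (atom i) = Vec.replicate _ 0
  neg :0 = Vec.replicate _ 0
  neg (s :+ t) = neg s ⊹ neg t
  neg (:- t) = pos t

  x-ε≈x : ∀ x → x - ε ≈ x
  x-ε≈x x = ≈-trans (∙-congˡ ε⁻¹≈ε) (identityʳ x)

  eval-correct : ∀ {n} (t : Expr n) ρ → eval t ρ ≈ dot (pos t) ρ - dot (neg t) ρ
  eval-correct (atom i) ρ =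
    ≈-sym (≈-trans (-‿cong (dot-unit i ρ) (dot-replicate-0 ρ)) (x-ε≈x _))
  eval-correct :0 ρ =
    ≈-sym (≈-trans (-‿cong (dot-replicate-0 ρ) (dot-replicate-0 ρ)) (x-ε≈x _))
  eval-correct (s :+ t) ρ = ≈-trans (∙-cong (eval-correct s ρ) (eval-correct t ρ))
    (≈-sym (≈-trans (-‿cong (dot-⊹ (pos s) (pos t) ρ) (dot-⊹ (neg s) (neg t) ρ))
                    (-‿interchange _ _ _ _)))
  eval-correct (:- t) ρ = ≈-trans (⁻¹-cong (eval-correct t ρ)) (⁻¹-anti-homo-// _ _)

  a∙d≈c∙b⇒a-b≈c-d : ∀ a b c d → a ∙ d ≈ c ∙ b → a - b ≈ c - d
  a∙d≈c∙b⇒a-b≈c-d a b c d eq = x∙y⁻¹≈ε⇒x≈y _ _ (begin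
    (a - b) - (c - d)       ≈⟨ ∙-congˡ (⁻¹-anti-homo-// c d) ⟩
    (a - b) ∙ (d - c)       ≈⟨ -‿interchange a d b c ⟨
    (a ∙ d) - (b ∙ c)       ≈⟨ -‿cong eq (comm b c) ⟩
    (c ∙ b) - (c ∙ b)       ≈⟨ inverseʳ _ ⟩
    ε                       ∎)

  solve : ∀ {n} (xs : Vec A n) (s t : Expr n) → pos s ⊹ neg t ≡ pos t ⊹ neg s →
          eval s (Vec.lookup xs) ≈ eval t (Vec.lookup xs)
  solve xs s t eq = ≈-trans (eval-correct s ρ) (≈-trans (a∙d≈c∙b⇒a-b≈c-d _ _ _ _ (begin
      dot (pos s) ρ ∙ dot (neg t) ρ ≈⟨ dot-⊹ (pos s) (neg t) ρ ⟨
      dot (pos s ⊹ neg t) ρ         ≈⟨ ≈-reflexive (≡.cong (λ c → dot c ρ) eq) ⟩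
      dot (pos t ⊹ neg s) ρ         ≈⟨ dot-⊹ (pos t) (neg s) ρ ⟩
      dot (pos t) ρ ∙ dot (neg s) ρ ∎)) (≈-sym (eval-correct t ρ)))
    where
    ρ = Vec.lookup xs

  ^-⋆-+ : ∀ p i j x → p ^ (i ℕ.+ j) ⋆ x ≈ p ^ i ⋆ p ^ j ⋆ x
  ^-⋆-+ p i j x = ≈-trans (⋆-congˡ (ℕₚ.^-distribˡ-+-* p i j)) (⋆-* (p ^ i) (p ^ j) x)

  -- A record rather than a Σ-type, so that `p`, `j` and `x` can be inferred from a proof.
  record Dv (p j : ℕ) (x : A) : Set where
    constructor div
    field
      quotient : A
      factor   : x ≈ p ^ j ⋆ quotient

  Dv-resp : ∀ {p j x y} → x ≈ y → Dv p j x → Dv p j y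
  Dv-resp x≈y (div b x≈) = div b (≈-trans (≈-sym x≈y) x≈)

  Dv-cast : ∀ {p j k x} → j ≡ k → Dv p j x → Dv p k x
  Dv-cast refl D = D

  Dv-ε : ∀ {p j} → Dv p j ε
  Dv-ε {p} {j} = div ε (≈-sym (⋆-ε (p ^ j)))

  Dv-∙ : ∀ {p j x y} → Dv p j x → Dv p j y → Dv p j (x ∙ y)
  Dv-∙ {p} {j} (div b x≈) (div c y≈) = div (b ∙ c) (≈-trans (∙-cong x≈ y≈) (≈-sym (⋆-∙ (p ^ j) b c)))

  Dv-sub : ∀ {p j x y} → Dv p j x → Dv p j y → Dv p j (x - y)
  Dv-sub {p} {j} (div b x≈) (div c y≈) = div (b - c) (≈-trans (-‿cong x≈ y≈) (≈-sym (⋆-sub (p ^ j) b c)))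

  Dv-⋆ : ∀ {p j x} k → Dv p j x → Dv p j (k ⋆ x)
  Dv-⋆ {p} {j} k (div b x≈) = div (k ⋆ b) (≈-trans (⋆-cong k x≈) (⋆-comm k (p ^ j) b))

  Dv-multiple : ∀ p j x → Dv p j (p ^ j ⋆ x)
  Dv-multiple p j x = div x ≈-refl

  Dv-≤ : ∀ {p i j x} → i ≤ j → Dv p j x → Dv p i x
  Dv-≤ {p} {i} {j} i≤j (div b x≈) = div (p ^ (j ∸ i) ⋆ b) (≈-trans x≈ (≈-trans
    (⋆-congˡ (≡.cong (p ^_) (≡.sym (ℕₚ.m+[n∸m]≡n i≤j)))) (^-⋆-+ p i (j ∸ i) b)))

  Dv-shift : ∀ {p j x} i → Dv p j x → Dv p (i ℕ.+ j) (p ^ i ⋆ x)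
  Dv-shift {p} {j} i (div b x≈) = div b (≈-trans (⋆-cong (p ^ i) x≈) (≈-sym (^-⋆-+ p i j b)))

  Dv-p⋆ : ∀ {p j x} → Dv p j x → Dv p (suc j) (p ⋆ x)
  Dv-p⋆ {p} {j} (div b x≈) = div b (≈-trans (⋆-cong p x≈) (≈-sym (⋆-* p (p ^ j) b)))

  Dv-suc⁻¹ : ∀ {p j x} → Dv p (suc j) x → Σ A λ y → (x ≈ p ⋆ y) × Dv p j y
  Dv-suc⁻¹ {p} {j} (div b x≈) = p ^ j ⋆ b , ≈-trans x≈ (⋆-* p (p ^ j) b) , Dv-multiple p j b

  Dv-0 : ∀ {p x} → Dv p 0 x
  Dv-0 {x = x} = div x (≈-sym (1⋆ x))

-- Divisibility in finite exponent.

module Exponent (G : AbelianGroup 0ℓ 0ℓ) (e : ℕ) (e≥1 : 1 ≤ e)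
                (e⋆ : ∀ a → AbelianGroup._≈_ G (_·_ G e a) (AbelianGroup.ε G)) where
  open AbelianGroup G renaming (Carrier to A; sym to ≈-sym; trans to ≈-trans; refl to ≈-refl; reflexive to ≈-reflexive)
  open GroupProperties group using (inverseʳ-unique)
  open GroupLemmas G

  e-1 : ℕ
  e-1 = e ∸ 1

  ⁻¹≈e-1⋆ : ∀ x → x ⁻¹ ≈ e-1 ⋆ x
  ⁻¹≈e-1⋆ x = ≈-sym (inverseʳ-unique _ _
    (≈-trans (⋆-congˡ (ℕₚ.m+[n∸m]≡n e≥1)) (e⋆ x)))

  infixl 6 _⊸_
  _⊸_ : ∀ {n} → Vec ℕ n → Vec ℕ n → Vec ℕ n
  c ⊸ d = c ⊹ Vec.map (e-1 *_) d

  dot-⊸ : ∀ {n} (c d : Vec ℕ n) ρ → dot (c ⊸ d) ρ ≈ dot c ρ - dot d ρ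
  dot-⊸ c d ρ = ≈-trans (dot-⊹ c _ ρ) (∙-congˡ (≈-trans (dot-map-* e-1 d ρ) (≈-sym (⁻¹≈e-1⋆ _))))

  inverse-mod : ∀ {p u} → Prime p → ¬ (p ∣ u) → ∀ j → Σ ℕ λ u' → ∀ x → Dv p j (u' ⋆ u ⋆ x - x)
  inverse-mod {p} {u} pp p∤u j with coprime-Bézout (coprime-prime-power pp p∤u j)
  ... | Bézout.+- x y eq = x , λ a → Dv-resp (≈-sym (begin
      x ⋆ u ⋆ a - a                   ≈⟨ ∙-congʳ (⋆-* x u a) ⟨
      (x * u) ⋆ a - a                 ≈⟨ ∙-congʳ (⋆-congˡ eq) ⟨
      (a ∙ (y * p ^ j) ⋆ a) - a       ≈⟨ solve (a ∷ (y * p ^ j) ⋆ a ∷ []) (v₀ :+ v₁ :- v₀) v₁ refl ⟩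
      (y * p ^ j) ⋆ a                 ≈⟨ ⋆-* y (p ^ j) a ⟩
      y ⋆ p ^ j ⋆ a                   ∎)) (Dv-⋆ y (Dv-multiple p j a))
    where open import Relation.Binary.Reasoning.Setoid setoid
  -- Here 1 + xu = ypʲ, so the inverse of u is -x, written with a natural coefficient.
  ... | Bézout.-+ x y eq = e-1 * x , λ a → Dv-resp (≈-sym (begin
      (e-1 * x) ⋆ u ⋆ a - a           ≈⟨ ∙-congʳ (⋆-* e-1 x (u ⋆ a)) ⟩
      e-1 ⋆ x ⋆ u ⋆ a - a             ≈⟨ ∙-congʳ (⁻¹≈e-1⋆ (x ⋆ u ⋆ a)) ⟨
      (x ⋆ u ⋆ a) ⁻¹ - a              ≈⟨ solve (a ∷ x ⋆ u ⋆ a ∷ []) (:- v₁ :- v₀) (:0 :- (v₀ :+ v₁)) refl ⟩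
      ε - (a ∙ x ⋆ u ⋆ a)             ≈⟨ -‿cong ≈-refl (∙-congˡ (⋆-* x u a)) ⟨
      ε - (1 ℕ.+ x * u) ⋆ a           ≈⟨ -‿cong ≈-refl (⋆-congˡ eq) ⟩
      ε - (y * p ^ j) ⋆ a             ≈⟨ -‿cong ≈-refl (⋆-* y (p ^ j) a) ⟩
      ε - y ⋆ p ^ j ⋆ a               ∎)) (Dv-sub Dv-ε (Dv-⋆ y (Dv-multiple p j a)))
    where open import Relation.Binary.Reasoning.Setoid setoid

  Dv-cancel : ∀ {p u} → Prime p → ¬ (p ∣ u) → ∀ {j x} → Dv p j (u ⋆ x) → Dv p j x
  Dv-cancel {u = u} pp p∤u {j} {x} D with inverse-mod pp p∤u j
  ... | u' , inv = Dv-resp (solve (u' ⋆ u ⋆ x ∷ x ∷ []) (v₀ :- (v₀ :- v₁)) v₁ refl)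
                           (Dv-sub (Dv-⋆ u' D) (inv x))

  module AtPrime {p : ℕ} (pp : Prime p) where

    abstract
      -- Write e = pᵐu with u prime to p. As pᵐu kills A, u kills pᵐA; and ux is killed by pᵐ, which
      -- is invertible modulo powers of any other prime q. So u annihilates everything away from p
      -- and moves all of A into the p-primary component.
      cofactor : Σ ℕ λ u → ¬ (p ∣ u) × (∀ {x} → Dv p e x → u ⋆ x ≈ ε) ×
                           (∀ {q} → Prime q → q ≢ p → ∀ x → Dv q e (u ⋆ x))
      cofactor with valuation pp e e≥1
      ... | m , u , e≡ , p∤u = u , p∤u , kills ∘ Dv-≤ m≤e , λ qq q≢p x →
        Dv-cancel-prime qq (q∤pᵐ qq q≢p m) (≈-trans (≈-sym (⋆-* (p ^ m) u x)) (pᵐu⋆ x))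
        where
        open import Relation.Binary.Reasoning.Setoid setoid
        u≢0 : u ≢ 0
        u≢0 refl = p∤u (divides 0 refl)
        m≤e : m ≤ e
        m≤e = ℕₚ.≤-trans (n≤p^n pp m) (ℕₚ.≤-trans
          (ℕₚ.m≤m*n (p ^ m) u {{ℕ.≢-nonZero u≢0}}) (ℕₚ.≤-reflexive (≡.sym e≡)))
        pᵐu⋆ : ∀ x → (p ^ m * u) ⋆ x ≈ ε
        pᵐu⋆ x = ≈-trans (⋆-congˡ (≡.sym e≡)) (e⋆ x)
        kills : ∀ {x} → Dv p m x → u ⋆ x ≈ ε
        kills {x} (div b x≈) = begin
          u ⋆ x             ≈⟨ ⋆-cong u x≈ ⟩
          u ⋆ p ^ m ⋆ b     ≈⟨ ⋆-comm u (p ^ m) b ⟩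
          p ^ m ⋆ u ⋆ b     ≈⟨ ⋆-* (p ^ m) u b ⟨
          (p ^ m * u) ⋆ b   ≈⟨ pᵐu⋆ b ⟩
          ε                 ∎
        Dv-cancel-prime : ∀ {q n x} → Prime q → ¬ (q ∣ n) → n ⋆ x ≈ ε → Dv q e x
        Dv-cancel-prime qq q∤n nx≈ε = Dv-cancel qq q∤n (Dv-resp (≈-sym nx≈ε) Dv-ε)
        q∤pᵐ : ∀ {q} → Prime q → q ≢ p → ∀ n → ¬ (q ∣ p ^ n)
        q∤pᵐ qq q≢p zero q∣1 = ¬prime[1] (≡.subst Prime (∣1⇒≡1 q∣1) qq)
        q∤pᵐ qq q≢p (suc n) q∣ with euclidsLemma p (p ^ n) qq q∣
        ... | inj₂ q∣pⁿ = q∤pᵐ qq q≢p n q∣pⁿ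
        ... | inj₁ q∣p with prime⇒irreducible pp q∣p
        ...   | inj₁ q≡1 = ¬prime[1] (≡.subst Prime q≡1 qq)
        ...   | inj₂ q≡p = q≢p q≡p

    -- An element of pᵉA has trivial p-component: the cofactor sends it to ε and can be cancelled.
    -- Hence only exponents up to `e` matter.
    Dv-stable : ∀ {j x} → Dv p e x → Dv p j x
    Dv-stable D = let _ , p∤u , kills , _ = cofactor in Dv-cancel pp p∤u (Dv-resp (≈-sym (kills D)) Dv-ε)

    Dv-⊓ : ∀ {j x} → Dv p (j ℕ.⊓ e) x → Dv p j x
    Dv-⊓ {j} D with ℕₚ.≤-total j e
    ... | inj₁ j≤e rewrite ℕₚ.m≤n⇒m⊓n≡m j≤e = D
    ... | inj₂ e≤j rewrite ℕₚ.m≥n⇒m⊓n≡n e≤j = Dv-stable D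

    ¬p∣e⇒Dv : ¬ (p ∣ e) → ∀ {j x} → Dv p j x
    ¬p∣e⇒Dv p∤e {x = x} = Dv-cancel pp p∤e (Dv-resp (≈-sym (e⋆ x)) Dv-ε)

-- Classical principles.

Separated : {X : Set} → (X → Set) → (X → X → Set) → ℕ → Set
Separated {X} Q E n = Σ (Fin n → X) λ f → (∀ j → Q (f j)) × (∀ j k → E (f j) (f k) → j ≡ k)

module Classical (lem : LEM) where

  -- In a longest separated family, an `x` in `Q` unrelated to every member could be put in front.
  -- Both directions of `E` occur because `E` is an arbitrary relation. The shape of `Separated` is
  -- that of `UInfinite`, so that a finite Ulm invariant yields a finite set of representatives.
  maximal-separated : ∀ {X : Set} (Q : X → Set) (E : X → X → Set) n → ¬ Separated Q E n →
    Σ ℕ λ N → Σ (Separated Q E N) λ { (f , _) → ∀ x → Q x → Σ (Fin N) λ j → E x (f j) ⊎ E (f j) x }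
  maximal-separated Q E zero ¬sep = ⊥-elim (¬sep ((λ ()) , (λ ()) , λ ()))
  maximal-separated {X} Q E (suc n) ¬sep with lem (Separated Q E n)
  ... | inj₂ ¬sepₙ = maximal-separated Q E n ¬sepₙ
  ... | inj₁ (f , f∈Q , f-inj) = n , (f , f∈Q , f-inj) , covers
    where
    covers : ∀ x → Q x → Σ (Fin n) λ j → E x (f j) ⊎ E (f j) x
    covers x x∈Q with lem (Σ (Fin n) λ j → E x (f j) ⊎ E (f j) x)
    ... | inj₁ c = c
    ... | inj₂ ¬c = ⊥-elim (¬sep (x F.∷ f , g∈Q , g-inj))
      where
      g∈Q : ∀ j → Q ((x F.∷ f) j)
      g∈Q zero = x∈Q
      g∈Q (suc j) = f∈Q j
      g-inj : ∀ j k → E ((x F.∷ f) j) ((x F.∷ f) k) → j ≡ k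
      g-inj zero zero _ = refl
      g-inj zero (suc k) E₀ₖ = ⊥-elim (¬c (k , inj₁ E₀ₖ))
      g-inj (suc j) zero Eⱼ₀ = ⊥-elim (¬c (j , inj₂ Eⱼ₀))
      g-inj (suc j) (suc k) Eⱼₖ = ≡.cong suc (f-inj j k Eⱼₖ)

  -- The default makes this total, so that a colouring can be defined before its colours are known
  -- to exist.
  choose : ∀ {X : Set} → (X → Set) → X → X
  choose P default with lem (Σ _ P)
  ... | inj₁ (x , _) = x
  ... | inj₂ _ = default

  choose-correct : ∀ {X : Set} (P : X → Set) default → Σ X P → P (choose P default)
  choose-correct P default ∃P with lem (Σ _ P)
  ... | inj₁ (_ , Px) = Px
  ... | inj₂ ¬∃P = ⊥-elim (¬∃P ∃P)

  ¬∀⇒∃¬ : {P : ℕ → Set} → ¬ (∀ n → P n) → Σ ℕ λ n → ¬ P n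
  ¬∀⇒∃¬ {P} ¬∀ with lem (Σ ℕ λ n → ¬ P n)
  ... | inj₁ ∃¬ = ∃¬
  ... | inj₂ ¬∃¬ = ⊥-elim (¬∀ λ n → double-negation (¬∃¬ ∘ (n ,_)))
    where
    double-negation : ∀ {n} → ¬ ¬ P n → P n
    double-negation {n} ¬¬P with lem (P n)
    ... | inj₁ Pn = Pn
    ... | inj₂ ¬Pn = ⊥-elim (¬¬P ¬Pn)

  last-true : (P : ℕ → Set) → P 0 → ∀ n → ¬ P n → Σ ℕ λ h → P h × ¬ P (suc h)
  last-true P P0 zero ¬P0 = ⊥-elim (¬P0 P0)
  last-true P P0 (suc n) ¬P with lem (P n)
  ... | inj₁ Pn = n , Pn , ¬P
  ... | inj₂ ¬Pn = last-true P P0 n ¬Pn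

-- Formulas are determined by divisibility conditions

module Elimination (lem : LEM) (G : AbelianGroup 0ℓ 0ℓ) (e : ℕ) (e≥1 : 1 ≤ e)
                   (e⋆ : ∀ a → AbelianGroup._≈_ G (_·_ G e a) (AbelianGroup.ε G)) where
  open AbelianGroup G renaming (Carrier to A; sym to ≈-sym; trans to ≈-trans; refl to ≈-refl; reflexive to ≈-reflexive)
  open GroupLemmas G
  open Exponent G e e≥1 e⋆
  open Classical lem

  Sim : ℕ → ∀ {n} → Vector A n → Vector A n → Set
  Sim p ρ σ = ∀ j c → Dv p j (dot c ρ) → Dv p j (dot c σ)

  _~[_]_ : ∀ {n} → Vector A n → ℕ → Vector A n → Set
  ρ ~[ p ] σ = Sim p ρ σ × Sim p σ ρ

  ~-sym : ∀ {p n} {ρ σ : Vector A n} → ρ ~[ p ] σ → σ ~[ p ] ρ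
  ~-sym (ρσ , σρ) = σρ , ρσ

  translate : ∀ {n} k (d c : Vec ℕ n) a ρ →
    k ⋆ a ∙ dot d ρ ≈ k ⋆ (a ∙ dot c ρ) ∙ dot (d ⊸ Vec.map (k *_) c) ρ
  translate k d c a ρ = ≈-sym (begin
    k ⋆ (a ∙ dot c ρ) ∙ dot (d ⊸ Vec.map (k *_) c) ρ
      ≈⟨ ∙-cong (⋆-∙ k a (dot c ρ)) (≈-trans (dot-⊸ d _ ρ) (-‿cong ≈-refl (dot-map-* k c ρ))) ⟩
    (k ⋆ a ∙ k ⋆ dot c ρ) ∙ (dot d ρ - k ⋆ dot c ρ)
      ≈⟨ solve (k ⋆ a ∷ k ⋆ dot c ρ ∷ dot d ρ ∷ []) ((v₀ :+ v₁) :+ (v₂ :- v₁)) (v₀ :+ v₂) refl ⟩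
    k ⋆ a ∙ dot d ρ ∎)
    where open import Relation.Binary.Reasoning.Setoid setoid

  Sim-translate : ∀ {p n} {ρ σ : Vector A n} {a b} c →
    Sim p ((a ∙ dot c ρ) F.∷ ρ) ((b ∙ dot c σ) F.∷ σ) → Sim p (a F.∷ ρ) (b F.∷ σ)
  Sim-translate {ρ = ρ} {σ} {a} {b} c S j (k ∷ d) D =
    Dv-resp (≈-sym (translate k d c b σ)) (S j (k ∷ (d ⊸ Vec.map (k *_) c)) (Dv-resp (translate k d c a ρ) D))

  Sim-head-resp : ∀ {p n} {ρ σ : Vector A n} {a a' b b'} → a ≈ a' → b ≈ b' →
    Sim p (a F.∷ ρ) (b F.∷ σ) → Sim p (a' F.∷ ρ) (b' F.∷ σ)
  Sim-head-resp a≈a' b≈b' S j (k ∷ c) D =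
    Dv-resp (∙-congʳ (⋆-cong k b≈b')) (S j (k ∷ c) (Dv-resp (∙-congʳ (⋆-cong k (≈-sym a≈a'))) D))

  -- Allows `a` to be replaced by any element of the coset a + ⟨ρ⟩ before a match is sought.
  ~-translate : ∀ {p n} {ρ σ : Vector A n} {a} c →
    (Σ A λ b → ((a ∙ dot c ρ) F.∷ ρ) ~[ p ] (b F.∷ σ)) → Σ A λ b → (a F.∷ ρ) ~[ p ] (b F.∷ σ)
  ~-translate {σ = σ} {a} c (b , S , S') = b - dot c σ ,
    Sim-translate c (Sim-head-resp ≈-refl b≈ S) , Sim-translate c (Sim-head-resp b≈ ≈-refl S')
    where
    b≈ : b ≈ (b - dot c σ) ∙ dot c σ
    b≈ = solve (b ∷ dot c σ ∷ []) v₀ (v₀ :- v₁ :+ v₁) refl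

  instance
    e≢0 : NonZero e
    e≢0 = ℕ.>-nonZero e≥1

  digit : ℕ → Fin e
  digit k = Fin.fromℕ< (m%n<n k e)

  -- Modulo `e` there are only `e ^ n` coefficient vectors, so ⟨ρ⟩ is finite; this starts the count
  -- in `new-socle-element`.
  residues : ∀ {n} → Vec ℕ n → Fin (e ^ n)
  residues [] = zero
  residues (k ∷ c) = Fin.combine (digit k) (residues c)

  ⋆-digit : ∀ k x → k ⋆ x ≈ Fin.toℕ (digit k) ⋆ x
  ⋆-digit k x = begin
    k ⋆ x                                ≈⟨ ⋆-congˡ (m≡m%n+[m/n]*n k e) ⟩
    (k % e ℕ.+ k / e * e) ⋆ x            ≈⟨ ⋆-+ (k % e) (k / e * e) x ⟩
    (k % e) ⋆ x ∙ (k / e * e) ⋆ x        ≈⟨ ∙-congˡ (⋆-* (k / e) e x) ⟩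
    (k % e) ⋆ x ∙ (k / e) ⋆ e ⋆ x        ≈⟨ ∙-congˡ (≈-trans (⋆-cong (k / e) (e⋆ x)) (⋆-ε (k / e))) ⟩
    (k % e) ⋆ x ∙ ε                      ≈⟨ identityʳ _ ⟩
    (k % e) ⋆ x                          ≈⟨ ⋆-congˡ (Finₚ.toℕ-fromℕ< (m%n<n k e)) ⟨
    Fin.toℕ (digit k) ⋆ x                ∎
    where open import Relation.Binary.Reasoning.Setoid setoid

  residues-dot : ∀ {n} (c d : Vec ℕ n) ρ → residues c ≡ residues d → dot c ρ ≈ dot d ρ
  residues-dot [] [] ρ eq = ≈-refl
  residues-dot (k ∷ c) (l ∷ d) ρ eq
    with Finₚ.combine-injective (digit k) (residues c) (digit l) (residues d) eq
  ... | k≡l , c≡d = ∙-cong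
    (≈-trans (⋆-digit k (ρ zero)) (≈-trans (⋆-congˡ (≡.cong Fin.toℕ k≡l)) (≈-sym (⋆-digit l (ρ zero)))))
    (residues-dot c d (ρ ∘ suc) c≡d)

  -- Adjoining one element, at one prime.

  module OnePrime {p : ℕ} (pp : Prime p) where
    open AtPrime pp

    Sim-negligible : ∀ {n} {ρ σ : Vector A n} {a b} → Sim p ρ σ → Dv p e a → Dv p e b →
                     Sim p (a F.∷ ρ) (b F.∷ σ)
    Sim-negligible {ρ = ρ} {σ} {a} {b} S Da Db j (k ∷ c) D =
      Dv-∙ (Dv-⋆ k (Dv-stable Db)) (S j c (Dv-resp
        (solve (k ⋆ a ∷ dot c ρ ∷ []) (v₀ :+ v₁ :- v₀) v₁ refl) (Dv-sub D (Dv-⋆ k (Dv-stable Da)))))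

    -- Kaplansky's proper elements: `a` has p-height exactly `h`, and no element of a + ⟨ρ⟩ has a
    -- greater one.
    Proper : ∀ {n} → ℕ → A → Vector A n → Set
    Proper h a ρ = Dv p h a × (∀ c → ¬ Dv p (suc h) (a ∙ dot c ρ))

    -- Consider pʲ ∣ ka + cρ. If p ∣ k, then ka lies in ⟨ρ⟩ by way of pa = c₁ρ. Otherwise k is
    -- invertible modulo pʲ, properness forces j ≤ h, and the terms ka and kb are divisible by pʲ
    -- and drop out.
    Sim-proper : ∀ {n} {ρ σ : Vector A n} {a b h} c₁ → Sim p ρ σ →
      p ⋆ a ≈ dot c₁ ρ → p ⋆ b ≈ dot c₁ σ → Proper h a ρ → Dv p h b → Sim p (a F.∷ ρ) (b F.∷ σ)
    Sim-proper {ρ = ρ} {σ} {a} {b} {h} c₁ S pa≈ pb≈ (Da , proper) Db j (k ∷ c) D with p ∣? k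
    ... | yes (divides q refl) = Dv-resp (reduce pb≈)
        (S j (Vec.map (q *_) c₁ ⊹ c) (Dv-resp (≈-sym (reduce pa≈)) D))
      where
      reduce : ∀ {x τ} → p ⋆ x ≈ dot c₁ τ → dot (Vec.map (q *_) c₁ ⊹ c) τ ≈ (q * p) ⋆ x ∙ dot c τ
      reduce {x} {τ} px≈ = ≈-trans (dot-⊹ (Vec.map (q *_) c₁) c τ) (∙-congʳ (≈-trans (dot-map-* q c₁ τ)
        (≈-trans (⋆-cong q (≈-sym px≈)) (≈-sym (⋆-* q p x)))))
    ... | no p∤k = Dv-∙ (Dv-⋆ k (Dv-≤ j≤h Db)) (S j c (Dv-resp
        (solve (k ⋆ a ∷ dot c ρ ∷ []) (v₀ :+ v₁ :- v₀) v₁ refl) (Dv-sub D (Dv-⋆ k (Dv-≤ j≤h Da)))))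
      where
      monic : Σ (Vec ℕ _) λ c' → Dv p j (a ∙ dot c' ρ)
      monic with inverse-mod pp p∤k j
      ... | k' , inv = Vec.map (k' *_) c , Dv-resp (≈-trans
        (-‿cong (⋆-∙ k' _ _) ≈-refl)
        (≈-trans (solve (k' ⋆ k ⋆ a ∷ k' ⋆ dot c ρ ∷ a ∷ []) (v₀ :+ v₁ :- (v₀ :- v₂)) (v₂ :+ v₁) refl)
                 (∙-congˡ (≈-sym (dot-map-* k' c ρ))))) (Dv-sub (Dv-⋆ k' D) (inv a))
      j≤h : j ≤ h
      j≤h with ℕₚ.≤-<-connex j h
      ... | inj₁ j≤h = j≤h
      ... | inj₂ h<j = ⊥-elim (proper (proj₁ monic) (Dv-≤ h<j (proj₂ monic)))

    ~-proper : ∀ {n} {ρ σ : Vector A n} {a b h} c₁ → ρ ~[ p ] σ →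
      p ⋆ a ≈ dot c₁ ρ → p ⋆ b ≈ dot c₁ σ → Proper h a ρ → Proper h b σ → (a F.∷ ρ) ~[ p ] (b F.∷ σ)
    ~-proper c₁ (S , S') pa≈ pb≈ Pa Pb =
      Sim-proper c₁ S pa≈ pb≈ Pa (proj₁ Pb) , Sim-proper c₁ S' pb≈ pa≈ Pb (proj₁ Pa)


    p⋆-translate : ∀ {n} {ρ : Vector A n} {a} c₁ c → p ⋆ a ≈ dot c₁ ρ →
                   p ⋆ (a ∙ dot c ρ) ≈ dot (c₁ ⊹ Vec.map (p *_) c) ρ
    p⋆-translate {ρ = ρ} {a} c₁ c pa≈ = ≈-trans (⋆-∙ p a (dot c ρ))
      (≈-sym (≈-trans (dot-⊹ c₁ _ ρ) (∙-cong (≈-sym pa≈) (dot-map-* p c ρ))))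

    -- Any `b` in pʰA with pb = c₁σ is proper: if pʰ⁺¹ divided b + cσ, then pʰ ∣ cσ and pʰ⁺² ∣ p(b +
    -- cσ), and carrying both back to ρ contradicts `none`.
    extend-A : ∀ {n} {ρ σ : Vector A n} {a h} c₁ → ρ ~[ p ] σ → p ⋆ a ≈ dot c₁ ρ → Proper h a ρ →
      ¬ (Σ (Vec ℕ n) λ c → Dv p h (a ∙ dot c ρ) × Dv p (2 ℕ.+ h) (p ⋆ (a ∙ dot c ρ))) →
      Σ A λ b → (p ⋆ b ≈ dot c₁ σ) × Proper h b σ
    extend-A {n} {ρ} {σ} {a} {h} c₁ (S , S') pa≈ (Da , proper) none
      with Dv-suc⁻¹ (S (suc h) c₁ (Dv-resp pa≈ (Dv-p⋆ Da)))
    ... | b , c₁σ≈pb , Db = b , ≈-sym c₁σ≈pb , Db , λ c D → none (c ,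
        Dv-∙ Da (S' h c (Dv-resp (solve (b ∷ dot c σ ∷ []) (v₀ :+ v₁ :- v₀) v₁ refl)
                                 (Dv-sub (Dv-≤ (ℕₚ.n≤1+n h) D) Db))) ,
        Dv-resp (≈-sym (p⋆-translate c₁ c pa≈)) (S' (2 ℕ.+ h) (c₁ ⊹ Vec.map (p *_) c)
          (Dv-resp (p⋆-translate c₁ c (≈-sym c₁σ≈pb)) (Dv-p⋆ D))))

    Socle : ℕ → A → Set
    Socle h x = Dv p h x × (p ⋆ x ≈ ε)

    -- If every element of (pʰA)[p] were congruent modulo pʰ⁺¹A to one of ⟨σ⟩,
    -- then |(pʰA)[p] / (pʰ⁺¹A)[p]| would be the number of classes of those c with
    -- pʰ ∣ cσ and pʰ⁺² ∣ pcσ; but ρ yields as many classes, plus that of x₀.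
    new-socle-element : ∀ {n} {ρ σ : Vector A n} {h x₀} → ρ ~[ p ] σ → Socle h x₀ →
      (∀ c → ¬ Dv p (suc h) (x₀ ∙ dot c ρ)) →
      Σ A λ x → Socle h x × (∀ c → ¬ Dv p (suc h) (x ∙ dot c σ))
    new-socle-element {n} {ρ} {σ} {h} {x₀} (S , S') x₀∈ x₀-proper
      with lem (Σ A λ x → Socle h x × (∀ c → ¬ Dv p (suc h) (x ∙ dot c σ)))
    ... | inj₁ found = found
    ... | inj₂ none = ⊥-elim (clash (Finₚ.pigeonhole (ℕₚ.n<1+n N) class))
      where
      -- These are the `c` for which cρ is congruent modulo pʰ⁺¹A to an element of (pʰA)[p].
      Q : Vec ℕ n → Set
      Q c = Dv p h (dot c ρ) × Dv p (2 ℕ.+ h) (p ⋆ dot c ρ)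
      E : Vec ℕ n → Vec ℕ n → Set
      E c d = Dv p (suc h) (dot c ρ - dot d ρ)

      represent : ∀ x → Socle h x → Σ (Vec ℕ n) λ c → Dv p (suc h) (x ∙ dot c σ)
      represent x x∈ with lem (Σ (Vec ℕ n) λ c → Dv p (suc h) (x ∙ dot c σ))
      ... | inj₁ c = c
      ... | inj₂ ¬c = ⊥-elim (none (x , x∈ , λ c D → ¬c (c , D)))

      represent-Q : ∀ x (x∈ : Socle h x) → Q (proj₁ (represent x x∈))
      represent-Q x x∈@(Dx , px≈ε) with represent x x∈
      ... | c , D = S' h c (Dv-resp (solve (x ∷ dot c σ ∷ []) (v₀ :+ v₁ :- v₀) v₁ refl)
                                    (Dv-sub (Dv-≤ (ℕₚ.n≤1+n h) D) Dx)) ,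
        Dv-resp (dot-map-* p c ρ) (S' (2 ℕ.+ h) (Vec.map (p *_) c) (Dv-resp
          (≈-trans (⋆-∙ p x (dot c σ)) (≈-trans (∙-congʳ px≈ε) (≈-trans (identityˡ _) (≈-sym (dot-map-* p c σ)))))
          (Dv-p⋆ D)))

      bounded : ¬ Separated Q E (suc (e ^ n))
      bounded (f , _ , f-inj) with Finₚ.pigeonhole (ℕₚ.n<1+n (e ^ n)) (residues ∘ f)
      ... | i , j , i<j , eq = Finₚ.<⇒≢ i<j (f-inj i j (Dv-resp
        (≈-sym (≈-trans (∙-congʳ (residues-dot (f i) (f j) ρ eq)) (inverseʳ _))) Dv-ε))

      system = maximal-separated Q E (suc (e ^ n)) bounded
      N : ℕ
      N = proj₁ system
      f : Fin N → Vec ℕ n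
      f = proj₁ (proj₁ (proj₂ system))
      f∈Q : ∀ r → Q (f r)
      f∈Q = proj₁ (proj₂ (proj₁ (proj₂ system)))
      f-inj : ∀ r s → E (f r) (f s) → r ≡ s
      f-inj = proj₂ (proj₂ (proj₁ (proj₂ system)))
      covers : ∀ c → Q c → Σ (Fin N) λ r → E c (f r) ⊎ E (f r) c
      covers = proj₂ (proj₂ system)

      w : Fin N → A
      w r = proj₁ (Dv-suc⁻¹ (proj₂ (f∈Q r)))
      w-Dv : ∀ r → Dv p (suc h) (w r)
      w-Dv r = proj₂ (proj₂ (Dv-suc⁻¹ (proj₂ (f∈Q r))))

      -- Each of the `N` classes is corrected by some `w r` in pʰ⁺¹A to a genuine socle element;
      -- with x₀ this makes N + 1 of them.
      x : Fin (suc N) → A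
      x zero = x₀
      x (suc r) = dot (f r) ρ - w r

      x∈ : ∀ r → Socle h (x r)
      x∈ zero = x₀∈
      x∈ (suc r) = Dv-sub (proj₁ (f∈Q r)) (Dv-≤ (ℕₚ.n≤1+n h) (w-Dv r)) ,
        ≈-trans (⋆-sub p _ _) (≈-trans (∙-congʳ (proj₁ (proj₂ (Dv-suc⁻¹ (proj₂ (f∈Q r)))))) (inverseʳ _))

      coeff : Fin (suc N) → Vec ℕ n
      coeff r = proj₁ (represent (x r) (x∈ r))

      class : Fin (suc N) → Fin N
      class r = proj₁ (covers (coeff r) (represent-Q (x r) (x∈ r)))

      E-orient : ∀ c d → E c d ⊎ E d c → E c d
      E-orient _ _ (inj₁ cd) = cd
      E-orient c d (inj₂ dc) = Dv-resp (solve (dot d ρ ∷ dot c ρ ∷ []) (:0 :- (v₀ :- v₁)) (v₁ :- v₀) refl)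
                                           (Dv-sub Dv-ε dc)

      class-E : ∀ r → E (coeff r) (f (class r))
      class-E r = E-orient (coeff r) (f (class r)) (proj₂ (covers (coeff r) (represent-Q (x r) (x∈ r))))

      congruent : ∀ r s → class r ≡ class s → Dv p (suc h) (x r - x s)
      congruent r s eq = Dv-resp
        (≈-trans (-‿cong ≈-refl (dot-⊸ (coeff r) (coeff s) σ))
          (solve (x r ∷ dot (coeff r) σ ∷ x s ∷ dot (coeff s) σ ∷ [])
                 ((v₀ :+ v₁) :- (v₂ :+ v₃) :- (v₁ :- v₃)) (v₀ :- v₂) refl))
        (Dv-sub (Dv-sub (proj₂ (represent (x r) (x∈ r))) (proj₂ (represent (x s) (x∈ s))))
          (S (suc h) (coeff r ⊸ coeff s) (Dv-resp
            (≈-trans (solve (dot (coeff r) ρ ∷ dot (f (class s)) ρ ∷ dot (coeff s) ρ ∷ [])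
                            ((v₀ :- v₁) :- (v₂ :- v₁)) (v₀ :- v₂) refl)
                     (≈-sym (dot-⊸ (coeff r) (coeff s) ρ)))
            (Dv-sub (≡.subst (λ t → E (coeff r) (f t)) eq (class-E r)) (class-E s)))))

      -- Two of these elements agree modulo pʰ⁺¹A. If one is x₀, it is congruent to an element of
      -- ⟨ρ⟩; if not, two representatives `f r` and `f s` were equivalent.
      clash : (Σ (Fin (suc N)) λ r → Σ (Fin (suc N)) λ s → r Fin.< s × class r ≡ class s) → ⊥
      clash (zero , suc s , _ , eq) = x₀-proper (Vec.map (e-1 *_) (f s)) (Dv-resp
        (≈-trans (solve (x₀ ∷ dot (f s) ρ ∷ w s ∷ []) ((v₀ :- (v₁ :- v₂)) :- v₂) (v₀ :- v₁) refl)
                 (∙-congˡ (≈-trans (⁻¹≈e-1⋆ _) (≈-sym (dot-map-* e-1 (f s) ρ)))))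
        (Dv-sub (congruent zero (suc s) eq) (w-Dv s)))
      clash (suc r , suc s , r<s , eq) = Finₚ.<⇒≢ r<s (≡.cong suc (f-inj r s (Dv-resp
        (solve (dot (f r) ρ ∷ w r ∷ dot (f s) ρ ∷ w s ∷ [])
               ((v₀ :- v₁ :- (v₂ :- v₃)) :+ (v₁ :- v₃)) (v₀ :- v₂) refl)
        (Dv-∙ (congruent (suc r) (suc s) eq) (Dv-sub (w-Dv r) (w-Dv s))))))

    -- Subtracting from `a` an element w of pʰ⁺¹A with pw = pa leaves a socle element that is new
    -- over ρ. A socle element new over σ, added to a p-th part w' of c₁σ in pʰ⁺¹A, is the required
    -- `b`.
    extend-B : ∀ {n} {ρ σ : Vector A n} {a h} c₁ → ρ ~[ p ] σ → p ⋆ a ≈ dot c₁ ρ → Proper h a ρ →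
      Dv p (2 ℕ.+ h) (p ⋆ a) → Σ A λ b → (p ⋆ b ≈ dot c₁ σ) × Proper h b σ
    extend-B {n} {ρ} {σ} {a} {h} c₁ S pa≈ (Da , proper) D
      with Dv-suc⁻¹ D | Dv-suc⁻¹ (proj₁ S (2 ℕ.+ h) c₁ (Dv-resp pa≈ D))
    ... | w , pa≈pw , Dw | w' , c₁σ≈pw' , Dw'
      with new-socle-element S
        (Dv-sub Da (Dv-≤ (ℕₚ.n≤1+n h) Dw) , ≈-trans (⋆-sub p a w) (≈-trans (∙-congʳ pa≈pw) (inverseʳ _)))
        (λ c D' → proper c (Dv-resp (solve (a ∷ w ∷ dot c ρ ∷ []) ((v₀ :- v₁ :+ v₂) :+ v₁) (v₀ :+ v₂) refl)
                                    (Dv-∙ D' Dw)))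
    ... | x , (Dx , px≈ε) , x-proper = w' ∙ x ,
      ≈-trans (⋆-∙ p w' x) (≈-trans (∙-cong (≈-sym c₁σ≈pw') px≈ε) (identityʳ _)) ,
      Dv-∙ (Dv-≤ (ℕₚ.n≤1+n h) Dw') Dx ,
      λ c D' → x-proper c (Dv-resp (solve (w' ∷ x ∷ dot c σ ∷ []) ((v₀ :+ v₁ :+ v₂) :- v₀) (v₁ :+ v₂) refl)
                                   (Dv-sub D' Dw'))

    Proper-translate : ∀ {n} {ρ : Vector A n} {a h} c → (∀ d → ¬ Dv p (suc h) (a ∙ dot d ρ)) →
      Dv p h (a ∙ dot c ρ) → Proper h (a ∙ dot c ρ) ρ
    Proper-translate {ρ = ρ} {a} c proper D = D , λ d D' → proper (c ⊹ d)
      (Dv-resp (≈-trans (assoc a _ _) (∙-congˡ (≈-sym (dot-⊹ c d ρ)))) D')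

    extend-proper : ∀ {n} {ρ σ : Vector A n} {a h} c₁ → ρ ~[ p ] σ → p ⋆ a ≈ dot c₁ ρ → Proper h a ρ →
      Σ A λ b → (a F.∷ ρ) ~[ p ] (b F.∷ σ)
    extend-proper {n} {ρ} {σ} {a} {h} c₁ S pa≈ Pa
      with lem (Σ (Vec ℕ n) λ c → Dv p h (a ∙ dot c ρ) × Dv p (2 ℕ.+ h) (p ⋆ (a ∙ dot c ρ)))
    ... | inj₂ none = let b , pb≈ , Pb = extend-A c₁ S pa≈ Pa none in b , ~-proper c₁ S pa≈ pb≈ Pa Pb
    ... | inj₁ (c , D , D') =
      let Pa' = Proper-translate c (proj₂ Pa) D
          pa'≈ = p⋆-translate c₁ c pa≈
          b , pb≈ , Pb = extend-B (c₁ ⊹ Vec.map (p *_) c) S pa'≈ Pa' D'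
      in ~-translate c (b , ~-proper (c₁ ⊹ Vec.map (p *_) c) S pa'≈ pb≈ Pa' Pb)

    -- If a + ⟨ρ⟩ meets pᵉA, that element is invisible at p and ε matches it. Otherwise heights in
    -- the coset stay below `e`, and an element of greatest height is proper.
    extend-p⋆∈ : ∀ {n} {ρ σ : Vector A n} {a} c₁ → ρ ~[ p ] σ → p ⋆ a ≈ dot c₁ ρ →
      Σ A λ b → (a F.∷ ρ) ~[ p ] (b F.∷ σ)
    extend-p⋆∈ {n} {ρ} {σ} {a} c₁ S pa≈ with lem (Σ (Vec ℕ n) λ c → Dv p e (a ∙ dot c ρ))
    ... | inj₁ (c , D) = ~-translate c (ε , Sim-negligible (proj₁ S) D Dv-ε , Sim-negligible (proj₂ S) Dv-ε D)
    ... | inj₂ ¬D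
      with last-true (λ h → Σ (Vec ℕ n) λ c → Dv p h (a ∙ dot c ρ)) (Vec.replicate n 0 , Dv-0) e ¬D
    ...   | h , (c , D) , max = ~-translate c (extend-proper (c₁ ⊹ Vec.map (p *_) c) S (p⋆-translate c₁ c pa≈)
              (Proper-translate c (λ d D' → max (d , D')) D))

    -- First pa is adjoined, then `a`, whose p-fold is now an entry of the tuple; finally pa is
    -- forgotten by giving it coefficient 0.
    extend-by-height : ∀ i {n} {ρ σ : Vector A n} {a} → ρ ~[ p ] σ → Dv p e (p ^ i ⋆ a) →
      Σ A λ b → (a F.∷ ρ) ~[ p ] (b F.∷ σ)
    extend-by-height zero {a = a} (S , S') D =
      let D' = Dv-resp (1⋆ a) D in ε , Sim-negligible S D' Dv-ε , Sim-negligible S' Dv-ε D'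
    extend-by-height (suc i) {ρ = ρ} {σ} {a} S D
      with extend-by-height i {a = p ⋆ a} S (Dv-resp
        (≈-trans (⋆-congˡ (ℕₚ.*-comm p (p ^ i))) (⋆-* (p ^ i) p a)) D)
    ... | b' , S₁ with extend-p⋆∈ {a = a} (unit zero) S₁ (≈-sym (dot-unit zero ((p ⋆ a) F.∷ ρ)))
    ...   | b , (S₂ , S₂') = b , drop S₂ , drop S₂'
      where
      drop : ∀ {x x' y y' n} {τ υ : Vector A n} → Sim p (x F.∷ x' F.∷ τ) (y F.∷ y' F.∷ υ) → Sim p (x F.∷ τ) (y F.∷ υ)
      drop S j (k ∷ c) D = Dv-resp (∙-congˡ (identityˡ _))
        (S j (k ∷ 0 ∷ c) (Dv-resp (∙-congˡ (≈-sym (identityˡ _))) D))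

    extend : ∀ {n} {ρ σ : Vector A n} a → ρ ~[ p ] σ → Σ A λ b → (a F.∷ ρ) ~[ p ] (b F.∷ σ)
    extend a S = extend-by-height e S (Dv-multiple p e a)

    ~-perturb : ∀ {n} {ρ σ : Vector A n} {a b b'} → Dv p e (b' - b) →
      (a F.∷ ρ) ~[ p ] (b F.∷ σ) → (a F.∷ ρ) ~[ p ] (b' F.∷ σ)
    ~-perturb {σ = σ} {b = b} {b'} D (S , S') =
      (λ { j (k ∷ c) Dj → Dv-resp (back k c) (Dv-∙ (S j (k ∷ c) Dj) (Dv-⋆ k (Dv-stable D))) }) ,
      (λ { j (k ∷ c) Dj → S' j (k ∷ c) (Dv-resp (forth k c) (Dv-sub Dj (Dv-⋆ k (Dv-stable D)))) })
      where
      back : ∀ k c → (k ⋆ b ∙ dot c σ) ∙ k ⋆ (b' - b) ≈ k ⋆ b' ∙ dot c σ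
      back k c = ≈-trans (∙-congˡ (⋆-sub k b' b)) (solve (k ⋆ b ∷ dot c σ ∷ k ⋆ b' ∷ [])
        ((v₀ :+ v₁) :+ (v₂ :- v₀)) (v₂ :+ v₁) refl)
      forth : ∀ k c → (k ⋆ b' ∙ dot c σ) - k ⋆ (b' - b) ≈ k ⋆ b ∙ dot c σ
      forth k c = ≈-trans (-‿cong ≈-refl (⋆-sub k b' b)) (solve (k ⋆ b ∷ dot c σ ∷ k ⋆ b' ∷ [])
        ((v₂ :+ v₁) :- (v₂ :- v₀)) (v₀ :+ v₁) refl)

  -- Gluing the primes together.

  _≋_ : ∀ {n} → Vector A n → Vector A n → Set
  ρ ≋ σ = ∀ {p} → Prime p → ρ ~[ p ] σ

  -- u'u is an idempotent modulo e: it is 1 modulo the powers of B and 0 modulo those of other primes.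
  extend-below : ∀ B {n} {ρ σ : Vector A n} a → ρ ≋ σ →
    Σ A λ b → ∀ {p} → Prime p → p < B → (a F.∷ ρ) ~[ p ] (b F.∷ σ)
  extend-below zero a S = ε , λ _ ()
  extend-below (suc B) {ρ = ρ} {σ} a S with extend-below B a S | prime? B
  ... | b , below | no ¬pB = b , λ {p} pp p<1+B → below pp
        (ℕₚ.≤∧≢⇒< (ℕₚ.≤-pred p<1+B) λ { refl → ¬pB pp })
  ... | b , below | yes pB = b' , correct
    where
    open AtPrime pB using (cofactor)
    u = proj₁ cofactor
    inv = inverse-mod pB (proj₁ (proj₂ cofactor)) e
    u' = proj₁ inv
    b₁ : A
    b₁ = proj₁ (OnePrime.extend pB a (S pB))
    δ : A
    δ = u ⋆ (b₁ - b)
    -- Modulo pᵉA, the added term turns `b` into `b₁` at p = `B` and vanishes at every other prime.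
    b' : A
    b' = b ∙ u' ⋆ δ
    b'-b₁ : Dv B e (b' - b₁)
    b'-b₁ = Dv-resp (solve (b ∷ u' ⋆ δ ∷ b₁ ∷ []) (v₁ :- (v₂ :- v₀)) (v₀ :+ v₁ :- v₂) refl) (proj₂ inv (b₁ - b))
    b'-b : ∀ {p} → Prime p → p ≢ B → Dv p e (b' - b)
    b'-b pp p≢B = Dv-resp (solve (b ∷ u' ⋆ δ ∷ []) v₁ (v₀ :+ v₁ :- v₀) refl)
      (Dv-⋆ u' (proj₂ (proj₂ (proj₂ cofactor)) pp p≢B (b₁ - b)))
    correct : ∀ {p} → Prime p → p < suc B → (a F.∷ ρ) ~[ p ] (b' F.∷ σ)
    correct {p} pp p<1+B with p ℕ.≟ B
    ... | yes refl = OnePrime.~-perturb pp b'-b₁ (proj₂ (OnePrime.extend pB a (S pB)))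
    ... | no p≢B = OnePrime.~-perturb pp (b'-b pp p≢B) (below pp (ℕₚ.≤∧≢⇒< (ℕₚ.≤-pred p<1+B) p≢B))

  back-and-forth : ∀ {n} {ρ σ : Vector A n} a → ρ ≋ σ → Σ A λ b → (a F.∷ ρ) ≋ (b F.∷ σ)
  -- A prime dividing `e` is below `suc e`; at any other prime all elements are divisible.
  back-and-forth {ρ = ρ} {σ} a S with extend-below (suc e) a S
  ... | b , below = b , correct
    where
    correct : (a F.∷ ρ) ≋ (b F.∷ σ)
    correct {p} pp with p ∣? e
    ... | yes p∣e = below pp (s≤s (∣⇒≤ p∣e))
    ... | no p∤e = (λ _ _ _ → AtPrime.¬p∣e⇒Dv pp p∤e) , (λ _ _ _ → AtPrime.¬p∣e⇒Dv pp p∤e)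

  p⋆x≈ε∧Dv⇒x≈ε : ∀ {p x} → Prime p → p ⋆ x ≈ ε → Dv p e x → x ≈ ε
  p⋆x≈ε∧Dv⇒x≈ε {p} {x} pp px≈ε D =
    combine (coprime-Bézout (coprime-prime-power pp (proj₁ (proj₂ cofactor)) 1))
    where
    open AtPrime pp using (cofactor)
    u = proj₁ cofactor
    vanish : ∀ k {n} → n ⋆ x ≈ ε → (k * n) ⋆ x ≈ ε
    vanish k {n} nx≈ε = ≈-trans (⋆-* k n x) (≈-trans (⋆-cong k nx≈ε) (⋆-ε k))
    ux≈ε : u ⋆ x ≈ ε
    ux≈ε = proj₁ (proj₂ (proj₂ cofactor)) D
    p¹x≈ε : p ^ 1 ⋆ x ≈ ε
    p¹x≈ε = ≈-trans (⋆-congˡ (ℕₚ.*-identityʳ p)) px≈ε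
    cancel : ∀ {m n} → 1 ℕ.+ m ≡ n → m ⋆ x ≈ ε → n ⋆ x ≈ ε → x ≈ ε
    cancel refl mx≈ε nx≈ε = ≈-trans (≈-sym (identityʳ x)) (≈-trans (∙-congˡ (≈-sym mx≈ε)) nx≈ε)
    combine : Bézout.Identity 1 u (p ^ 1) → x ≈ ε
    combine (Bézout.+- i j eq) = cancel eq (vanish j p¹x≈ε) (vanish i ux≈ε)
    combine (Bézout.-+ i j eq) = cancel eq (vanish i ux≈ε) (vanish j p¹x≈ε)

  -- The prime factors of `e` are stripped off one at a time: an element killed by p with trivial
  -- p-component is ε.
  Dv-all⇒≈ε : ∀ {x} → (∀ {p} → Prime p → Dv p e x) → x ≈ ε
  Dv-all⇒≈ε {x} D = go factors factorsPrime x D (≈-trans (⋆-congˡ (≡.sym isFactorisation)) (e⋆ x))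
    where
    open PrimeFactorisation (factorise e)
    go : ∀ ps → All Prime ps → ∀ y → (∀ {p} → Prime p → Dv p e y) → product ps ⋆ y ≈ ε → y ≈ ε
    go [] [] y D 1y≈ε = ≈-trans (≈-sym (1⋆ y)) 1y≈ε
    go (p ∷ ps) (pp ∷ pps) y D eq = go ps pps y D (p⋆x≈ε∧Dv⇒x≈ε pp
      (≈-trans (≈-sym (⋆-* p (product ps) y)) eq) (Dv-⋆ (product ps) (D pp)))

  coefficients : ∀ {n} → Term n → Vec ℕ n
  coefficients (var i) = unit i
  coefficients `0 = Vec.replicate _ 0
  coefficients (s ⊕ t) = coefficients s ⊹ coefficients t

  ⟦⟧≈dot : ∀ {n} (t : Term n) ρ → ⟦_⟧ G t ρ ≈ dot (coefficients t) ρ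
  ⟦⟧≈dot (var i) ρ = ≈-sym (dot-unit i ρ)
  ⟦⟧≈dot `0 ρ = ≈-sym (dot-replicate-0 ρ)
  ⟦⟧≈dot (s ⊕ t) ρ = ≈-trans (∙-cong (⟦⟧≈dot s ρ) (⟦⟧≈dot t ρ))
    (≈-sym (dot-⊹ (coefficients s) (coefficients t) ρ))

  -- An equation says that a linear form is divisible by pᵉ for every prime p. Negation uses the
  -- symmetry of the relation, and the quantifier uses back-and-forth.
  Sat-≋ : ∀ {n} (φ : Formula n) {ρ σ : Vector A n} → ρ ≋ σ → Sat G φ ρ → Sat G φ σ
  Sat-≋ (s ≐ t) {ρ} {σ} S eq = x∙y⁻¹≈ε⇒x≈y _ _ (≈-trans (difference σ)
      (Dv-all⇒≈ε λ pp → proj₁ (S pp) e c (Dv-resp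
        (≈-trans (≈-sym (x≈y⇒x∙y⁻¹≈ε eq)) (difference ρ)) Dv-ε)))
    where
    open GroupProperties group using (x∙y⁻¹≈ε⇒x≈y; x≈y⇒x∙y⁻¹≈ε)
    c = coefficients s ⊸ coefficients t
    difference : ∀ τ → ⟦_⟧ G s τ - ⟦_⟧ G t τ ≈ dot c τ
    difference τ = ≈-trans (-‿cong (⟦⟧≈dot s τ) (⟦⟧≈dot t τ))
      (≈-sym (dot-⊸ (coefficients s) (coefficients t) τ))
  Sat-≋ (¬' φ) S ¬φ φσ = ¬φ (Sat-≋ φ (λ pp → ~-sym (S pp)) φσ)
  Sat-≋ (φ ∧' ψ) S (φρ , ψρ) = Sat-≋ φ S φρ , Sat-≋ ψ S ψρ
  Sat-≋ (∃' φ) S (a , φaρ) = let b , S' = back-and-forth a S in b , Sat-≋ φ S' φaρ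

-- Finite index

module _ {X : Set} where

  -- Besides equivalence relations this admits relations that only restrict the second argument,
  -- such as `Meets` below.
  Euclidean : (X → X → Set) → Set
  Euclidean R = ∀ {u v w} → R u v → R u w → R v w

  -- "V has at most N classes on each class of R", witnessed by colourings that
  -- may depend on a base point u₀ of the R-class.
  FI : ℕ → (X → X → Set) → (X → X → Set) → Set
  FI N R V = Σ (X → X → Fin N) λ col →
    ∀ u₀ u v → R u₀ u → R u₀ v → col u₀ u ≡ col u₀ v → V u v

  FI-⊆ : ∀ {R V} → Euclidean R → (∀ {u v} → R u v → V u v) → FI 1 R V
  FI-⊆ R-euc R⊆V = (λ _ _ → zero) , λ _ _ _ Ru Rv _ → R⊆V (R-euc Ru Rv)

  FI-mono : ∀ {N R R' V V'} → (∀ {u v} → R' u v → R u v) → (∀ {u v} → V u v → V' u v) →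
            FI N R V → FI N R' V'
  FI-mono R'⊆R V⊆V' (col , sound) =
    col , λ u₀ u v Ru Rv eq → V⊆V' (sound u₀ u v (R'⊆R Ru) (R'⊆R Rv) eq)

  FI-× : ∀ {N M R V V'} → FI N R V → FI M R V' → FI (N * M) R (λ u v → V u v × V' u v)
  FI-× (col , sound) (col' , sound') =
    (λ u₀ u → Fin.combine (col u₀ u) (col' u₀ u)) , λ u₀ u v Ru Rv eq →
      let eq₁ , eq₂ = Finₚ.combine-injective (col u₀ u) (col' u₀ u) (col u₀ v) (col' u₀ v) eq
      in sound u₀ u v Ru Rv eq₁ , sound' u₀ u v Ru Rv eq₂

  FI-All : ∀ {R} {I : Set} {V : I → X → X → Set} (xs : List I) →
    (∀ {x} → x ∈ xs → Σ ℕ λ N → FI N R (V x)) →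
    Σ ℕ λ N → FI N R (λ u v → ∀ {x} → x ∈ xs → V x u v)
  FI-All [] fi = 1 , (λ _ _ → zero) , λ { _ _ _ _ _ _ () }
  FI-All (x ∷ xs) fi with fi (here refl) | FI-All xs (fi ∘ there)
  ... | N , fiₓ | M , fiₓₛ = N * M , FI-mono (λ Ruv → Ruv)
    (λ { (Vₓ , Vₓₛ) (here refl) → Vₓ ; (Vₓ , Vₓₛ) (there x∈) → Vₓₛ x∈ }) (FI-× fiₓ fiₓₛ)

  -- Indices multiply in a tower. The second colouring needs a base point in the finer class, so one
  -- is chosen for each colour of the first.
  FI-trans : LEM → ∀ {N M R W V} → Euclidean R → FI N R W → FI M (λ u v → R u v × W u v) V → FI (N * M) R V
  FI-trans lem {N} {M} {R} {W} {V} R-euc (col , sound) (col' , sound') =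
    (λ u₀ u → Fin.combine (col u₀ u) (col' (base u₀ (col u₀ u)) u)) , total
    where
    open Classical lem
    Class : X → Fin N → X → Set
    Class u₀ c u = R u₀ u × col u₀ u ≡ c
    base : X → Fin N → X
    base u₀ c = choose (Class u₀ c) u₀
    total : ∀ u₀ u v → R u₀ u → R u₀ v →
      Fin.combine (col u₀ u) (col' (base u₀ (col u₀ u)) u) ≡
      Fin.combine (col u₀ v) (col' (base u₀ (col u₀ v)) v) → V u v
    total u₀ u v Ru Rv eq
      with Finₚ.combine-injective (col u₀ u) (col' (base u₀ (col u₀ u)) u) (col u₀ v) (col' (base u₀ (col u₀ v)) v) eq
    ... | eq₁ , eq₂ = sound' b u v
        (R-euc Rb Ru , sound u₀ b u Rb Ru cb)
        (R-euc Rb Rv , sound u₀ b v Rb Rv (≡.trans cb eq₁))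
        (≡.trans eq₂ (≡.cong (λ c → col' (base u₀ c) v) (≡.sym eq₁)))
      where
      b = base u₀ (col u₀ u)
      Cb : Class u₀ (col u₀ u) b
      Cb = choose-correct (Class u₀ (col u₀ u)) u₀ (u , Ru , refl)
      Rb = proj₁ Cb
      cb = proj₂ Cb

FI-on : ∀ {X Y : Set} {N} {R V : Y → Y → Set} (f : X → Y) → FI N R V →
        FI N (λ u v → R (f u) (f v)) (λ u v → V (f u) (f v))
FI-on f (col , sound) = (λ u₀ u → col (f u₀) (f u)) , λ u₀ u v → sound (f u₀) (f u) (f v)

-- The subgroup {x : pʲ ∣ pⁱx} of a cyclic group of order pⁿ is generated by pʰ with h = height (i , j) n.
height : ℕ × ℕ → ℕ → ℕ
height (i , j) n = (j ∸ i) ⊓ (n ∸ i)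

-- Finite index for conditions in one variable.

module FiniteIndex (lem : LEM) (G : AbelianGroup 0ℓ 0ℓ) (e : ℕ) (e≥1 : 1 ≤ e)
                   (e⋆ : ∀ a → AbelianGroup._≈_ G (_·_ G e a) (AbelianGroup.ε G))
                   {p : ℕ} (pp : Prime p) where
  open AbelianGroup G renaming (Carrier to A; sym to ≈-sym; trans to ≈-trans; refl to ≈-refl; reflexive to ≈-reflexive)
  open GroupLemmas G
  open Exponent G e e≥1 e⋆
  open Classical lem
  open AtPrime pp

  Diff : (A → Set) → A → A → Set
  Diff P x y = P (x - y)

  Diff-euclidean : (P : A → Set) → (∀ {x y} → x ≈ y → P x → P y) → (∀ {x y} → P x → P y → P (x - y)) →
                   Euclidean (Diff P)
  Diff-euclidean P resp sub {u} {v} {w} Puv Puw =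
    resp (solve (u ∷ v ∷ w ∷ []) ((v₀ :- v₂) :- (v₀ :- v₁)) (v₁ :- v₂) refl) (sub Puw Puv)

  ¬UInfinite⇒finite : ∀ {i} → ¬ UInfinite G p i → Σ ℕ λ N → Σ (Fin N → A) λ f →
    ∀ x → Dv p i x → p ⋆ x ≈ ε → Σ (Fin N) λ r → Dv p (suc i) (x - f r)
  ¬UInfinite⇒finite {i} ¬inf
    with ¬∀⇒∃¬ ¬inf
  ... | n , ¬sep with maximal-separated (InPiAp G p i) (λ x y → InPiAp G p (suc i) (x - y)) n ¬sep
  ... | N , (f , _) , covers = N , f , λ x (div b x≈) px≈ε → orient (covers x (px≈ε , b , x≈))
    where
    orient : ∀ {x} → (Σ (Fin N) λ r → InPiAp G p (suc i) (x - f r) ⊎ InPiAp G p (suc i) (f r - x)) →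
             Σ (Fin N) λ r → Dv p (suc i) (x - f r)
    orient (r , inj₁ (_ , b , eq)) = r , div b eq
    orient {x} (r , inj₂ (_ , b , eq)) = r , Dv-resp
      (solve (f r ∷ x ∷ []) (:0 :- (v₀ :- v₁)) (v₁ :- v₀) refl) (Dv-sub Dv-ε (div b eq))

  -- `Q v 0` is pᵛ⁺¹ ∣ w, and `W v s` is pᵛ ∣ w together with `Q v (suc s)`. Passing from `W v s` to
  -- `Q v s` involves the single Ulm invariant U(p, v+s).
  W Q : ℕ → ℕ → A → Set
  W v s w = Dv p v w × Dv p (2 ℕ.+ (v ℕ.+ s)) (p ^ suc s ⋆ w)
  Q v s w = Dv p (suc (v ℕ.+ s)) (p ^ s ⋆ w)

  -- For y in pᵛ⁺ˢ⁺¹A with py = pˢ⁺¹w, the element pˢw - y lies in the socle (pᵛ⁺ˢA)[p], which has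
  -- finitely many classes modulo pᵛ⁺ˢ⁺¹A. The class is the colour of w.
  finite-step : ∀ v s → ¬ UInfinite G p (v ℕ.+ s) → Σ ℕ λ N → FI N (Diff (W v s)) (Diff (Q v s))
  finite-step v s ¬inf = N , (λ u₀ u → choose (Col (u₀ - u)) r₀) , sound
    where
    reps = ¬UInfinite⇒finite ¬inf
    N = proj₁ reps
    f = proj₁ (proj₂ reps)
    covers = proj₂ (proj₂ reps)
    Col : A → Fin N → Set
    Col w r = Dv p (suc (v ℕ.+ s)) (p ^ s ⋆ w - f r)
    -- The representatives also cover ε, so there is a default colour.
    r₀ : Fin N
    r₀ = proj₁ (covers ε Dv-ε (⋆-ε p))
    colour : ∀ w → W v s w → Σ (Fin N) (Col w)
    colour w (D , D') with Dv-suc⁻¹ (Dv-resp (⋆-* p (p ^ s) w) D')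
    ... | y , eq , Dy
      with covers (p ^ s ⋆ w - y)
        (Dv-sub (Dv-cast (ℕₚ.+-comm s v) (Dv-shift s D)) (Dv-≤ (ℕₚ.n≤1+n _) Dy))
        (≈-trans (⋆-sub p _ y) (≈-trans (∙-congʳ eq) (inverseʳ _)))
    ...   | r , Dr = r , Dv-resp (solve (p ^ s ⋆ w ∷ y ∷ f r ∷ []) ((v₀ :- v₁ :- v₂) :+ v₁) (v₀ :- v₂) refl) (Dv-∙ Dr Dy)
    sound : ∀ u₀ u v' → Diff (W v s) u₀ u → Diff (W v s) u₀ v' →
      choose (Col (u₀ - u)) r₀ ≡ choose (Col (u₀ - v')) r₀ → Diff (Q v s) u v'
    sound u₀ u v' Wu Wv eq = Dv-resp eq' (Dv-sub Cv Cu)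
      where
      r = choose (Col (u₀ - v')) r₀
      Cv : Col (u₀ - v') r
      Cv = choose-correct (Col (u₀ - v')) r₀ (colour _ Wv)
      Cu : Col (u₀ - u) r
      Cu = ≡.subst (Col (u₀ - u)) eq (choose-correct (Col (u₀ - u)) r₀ (colour _ Wu))
      eq' : (p ^ s ⋆ (u₀ - v') - f r) - (p ^ s ⋆ (u₀ - u) - f r) ≈ p ^ s ⋆ (u - v')
      eq' = ≈-trans (-‿cong (∙-congʳ (⋆-sub (p ^ s) u₀ v')) (∙-congʳ (⋆-sub (p ^ s) u₀ u)))
        (≈-trans (solve (p ^ s ⋆ u₀ ∷ p ^ s ⋆ v' ∷ p ^ s ⋆ u ∷ f r ∷ [])
                        (v₀ :- v₁ :- v₃ :- (v₀ :- v₂ :- v₃)) (v₂ :- v₁) refl)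
                 (≈-sym (⋆-sub (p ^ s) u v')))

  -- The subgroups {pʲ ∣ pⁱx} + {pʲ' ∣ pⁱ'x} are again of the form {pᴵ⁺ᴶ ∣ pᴵx}.
  I J : ℕ × ℕ → ℕ × ℕ → ℕ
  I (i , j) (i' , j') = i ⊔ i'
  J (i , j) (i' , j') = (j ∸ i) ⊓ (j' ∸ i')

  -- On each summand Z(pⁿ⁺¹) occurring infinitely often, the subgroup of some `r` lies inside that
  -- of (i , j). If n < i or j ≤ i, the latter is the whole summand and nothing is demanded.
  Dominated : ℕ × ℕ → List (ℕ × ℕ) → Set
  Dominated (i , j) rs = ∀ n → UInfinite G p n → i ≤ n → i < j →
    Σ (ℕ × ℕ) λ r → r ∈ rs × height (i , j) (suc n) ≤ height r (suc n)

  -- Here w stands for pⁱx, possibly with terms in further variables; x is to lie in the sum of the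
  -- subgroup of `k` with that of each `r`.
  Sums : ℕ × ℕ → List (ℕ × ℕ) → A → Set
  Sums k@(i , _) rs w = Dv p i w × (∀ {r} → r ∈ rs → Dv p (I k r ℕ.+ J k r) (p ^ (I k r ∸ i) ⋆ w))

  module Gap {i j} (i≤j : i ≤ j) {rs} (dominated : Dominated (i , j) rs) where
    H : A → Set
    H = Sums (i , j) rs

    H-euclidean : Euclidean (Diff H)
    H-euclidean = Diff-euclidean H
      (λ x≈y (D , Dr) → Dv-resp x≈y D , λ {r} r∈ → Dv-resp (⋆-cong (p ^ (I (i , j) r ∸ i)) x≈y) (Dr r∈))
      (λ (D , Dr) (D' , Dr') → Dv-sub D D' , λ {r} r∈ → Dv-resp (≈-sym (⋆-sub (p ^ (I (i , j) r ∸ i)) _ _)) (Dv-sub (Dr r∈) (Dr' r∈)))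

    -- Domination at n = v + s gives an `r` with I - i ≤ s and J ≥ v + 1 - i. Its condition,
    -- multiplied by the missing power of p, is `Q v s`.
    infinite-step : ∀ {v s w} → i ≤ v → v < j → UInfinite G p (v ℕ.+ s) → H w → Q v s w
    infinite-step {v} {s} {w} i≤v v<j inf (_ , Dr)
      with dominated (v ℕ.+ s) inf (ℕₚ.≤-trans i≤v (ℕₚ.m≤m+n v s)) (ℕₚ.≤-<-trans i≤v v<j)
    ... | r@(i' , j') , r∈ , hᵢ≤hᵣ = Dv-≤ bound (Dv-resp
        (≈-trans (≈-sym (^-⋆-+ p (s ∸ x) x w)) (⋆-congˡ (≡.cong (p ^_) (ℕₚ.m∸n+n≡m x≤s))))
        (Dv-shift (s ∸ x) (Dr r∈)))
      where
      open ℕₚ.≤-Reasoning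
      n = v ℕ.+ s
      x = (i ⊔ i') ∸ i
      h≤ : suc v ∸ i ≤ height r (suc n)
      h≤ = ℕₚ.≤-trans (ℕₚ.⊓-glb (ℕₚ.∸-monoˡ-≤ i v<j) (ℕₚ.∸-monoˡ-≤ i (s≤s (ℕₚ.m≤m+n v s)))) hᵢ≤hᵣ
      i+h≡ : i ℕ.+ (suc v ∸ i) ≡ suc v
      i+h≡ = ℕₚ.m+[n∸m]≡n (ℕₚ.m≤n⇒m≤1+n i≤v)
      i'≤1+n : i' ≤ suc n
      i'≤1+n with ℕₚ.≤-total i' (suc n)
      ... | inj₁ le = le
      ... | inj₂ ge = ⊥-elim (ℕₚ.m>n⇒m∸n≢0 (s≤s i≤v) (ℕₚ.n≤0⇒n≡0
        (ℕₚ.≤-trans h≤ (ℕₚ.≤-trans (ℕₚ.m⊓n≤n (j' ∸ i') _) (ℕₚ.≤-reflexive (ℕₚ.m≤n⇒m∸n≡0 ge))))))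
      i'≤i+s : i' ≤ i ℕ.+ s
      i'≤i+s = ℕₚ.+-cancelʳ-≤ (suc v) _ _ (begin
        i' ℕ.+ suc v                      ≡⟨ ≡.cong (i' ℕ.+_) i+h≡ ⟨
        i' ℕ.+ (i ℕ.+ (suc v ∸ i))        ≡⟨ ℕₚ.+-assoc i' i _ ⟨
        i' ℕ.+ i ℕ.+ (suc v ∸ i)          ≡⟨ ≡.cong (ℕ._+ (suc v ∸ i)) (ℕₚ.+-comm i' i) ⟩
        i ℕ.+ i' ℕ.+ (suc v ∸ i)          ≡⟨ ℕₚ.+-assoc i i' _ ⟩
        i ℕ.+ (i' ℕ.+ (suc v ∸ i))        ≤⟨ ℕₚ.+-monoʳ-≤ i (ℕₚ.+-monoʳ-≤ i' (ℕₚ.≤-trans h≤ (ℕₚ.m⊓n≤n (j' ∸ i') _))) ⟩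
        i ℕ.+ (i' ℕ.+ (suc n ∸ i'))       ≡⟨ ≡.cong (i ℕ.+_) (ℕₚ.m+[n∸m]≡n i'≤1+n) ⟩
        i ℕ.+ suc (v ℕ.+ s)               ≡⟨ ≡.cong (i ℕ.+_) (ℕₚ.+-comm (suc v) s) ⟩
        i ℕ.+ (s ℕ.+ suc v)               ≡⟨ ℕₚ.+-assoc i s (suc v) ⟨
        i ℕ.+ s ℕ.+ suc v                 ∎)
      x≤s : x ≤ s
      x≤s = ℕₚ.m≤n+o⇒m∸n≤o _ i (ℕₚ.⊔-lub (ℕₚ.m≤m+n i s) i'≤i+s)
      bound : suc (v ℕ.+ s) ≤ s ∸ x ℕ.+ (I (i , j) r ℕ.+ J (i , j) r)
      bound = begin
        suc v ℕ.+ s                               ≡⟨ ℕₚ.+-comm (suc v) s ⟩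
        s ℕ.+ suc v                               ≡⟨ ≡.cong₂ ℕ._+_ (ℕₚ.m∸n+n≡m x≤s) i+h≡ ⟨
        (s ∸ x ℕ.+ x) ℕ.+ (i ℕ.+ (suc v ∸ i))     ≡⟨ ℕₚ.+-assoc (s ∸ x) x _ ⟩
        s ∸ x ℕ.+ (x ℕ.+ (i ℕ.+ (suc v ∸ i)))     ≡⟨ ≡.cong (s ∸ x ℕ.+_) (ℕₚ.+-assoc x i _) ⟨
        s ∸ x ℕ.+ (x ℕ.+ i ℕ.+ (suc v ∸ i))       ≡⟨ ≡.cong (λ t → s ∸ x ℕ.+ (t ℕ.+ (suc v ∸ i))) (ℕₚ.m∸n+n≡m (ℕₚ.m≤m⊔n i i')) ⟩
        s ∸ x ℕ.+ (i ⊔ i' ℕ.+ (suc v ∸ i))        ≤⟨ ℕₚ.+-monoʳ-≤ (s ∸ x) (ℕₚ.+-monoʳ-≤ (i ⊔ i')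
                                                       (ℕₚ.⊓-glb (ℕₚ.∸-monoˡ-≤ i v<j) (ℕₚ.≤-trans h≤ (ℕₚ.m⊓n≤m _ _)))) ⟩
        s ∸ x ℕ.+ (I (i , j) r ℕ.+ J (i , j) r)   ∎

    -- For s ≥ e, pˢw has trivial p-component and `Q v s` is automatic. Going down from s + 1 to s
    -- is free when U(p, v+s) is infinite and of finite index when it is not.
    descend : ∀ fuel {v} s → i ≤ v → v < j → e ≤ fuel ℕ.+ s →
      (Σ ℕ λ N → FI N (Diff H) (Diff (Dv p v))) → Σ ℕ λ N → FI N (Diff H) (Diff (Q v s))
    descend zero {v} s _ _ e≤s (N , fi) = N , FI-mono (λ h → h) (λ D → Dv-stable (Dv-≤
      (ℕₚ.≤-trans e≤s (ℕₚ.m≤m+n s v)) (Dv-shift s D))) fi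
    descend (suc fuel) {v} s i≤v v<j e≤ fi with lem (UInfinite G p (v ℕ.+ s))
    ... | inj₁ inf = 1 , FI-⊆ H-euclidean (infinite-step i≤v v<j inf)
    ... | inj₂ ¬inf =
      let M , fi' = descend fuel (suc s) i≤v v<j (ℕₚ.≤-trans e≤ (ℕₚ.≤-reflexive (≡.sym (ℕₚ.+-suc fuel s)))) fi
          K , fi″ = finite-step v s ¬inf
      in _ , FI-trans lem H-euclidean (FI-× (proj₂ fi) fi')
           (FI-mono (λ (_ , D , D') → D , Dv-cast (≡.cong suc (ℕₚ.+-suc v s)) D') (λ q → q) fi″)

    ascend : ∀ k → k ℕ.+ i ≤ j → Σ ℕ λ N → FI N (Diff H) (Diff (Dv p (k ℕ.+ i)))
    ascend zero _ = 1 , FI-⊆ H-euclidean proj₁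
    ascend (suc k) k+i<j =
      let N , fi = descend e 0 (ℕₚ.m≤n+m i k) k+i<j (ℕₚ.≤-reflexive (≡.sym (ℕₚ.+-identityʳ e)))
                     (ascend k (ℕₚ.<⇒≤ k+i<j))
      in N , FI-mono (λ h → h) (λ D → Dv-resp (1⋆ _) (Dv-cast (≡.cong suc (ℕₚ.+-identityʳ (k ℕ.+ i))) D)) fi

    gap : Σ ℕ λ N → FI N (Diff H) (Diff (Dv p j))
    gap = let N , fi = ascend (j ∸ i) (ℕₚ.≤-reflexive eq) in
          N , FI-mono (λ h → h) (Dv-cast eq) fi
      where
      eq = ℕₚ.m∸n+n≡m i≤j

-- Selecting the dominating conditions.

module _ {K : Set} where

  argmax : ∀ {Q : K → Set} → (∀ x → Dec (Q x)) → (μ : K → ℕ) (xs : List K) →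
    (∀ {x} → x ∈ xs → ¬ Q x) ⊎ Σ K λ y → y ∈ xs × Q y × (∀ {x} → x ∈ xs → Q x → μ x ≤ μ y)
  argmax Q? μ [] = inj₁ λ ()
  argmax Q? μ (z ∷ xs) with Q? z | argmax Q? μ xs
  ... | no ¬Qz | inj₁ none = inj₁ λ { (here refl) → ¬Qz ; (there x∈) → none x∈ }
  ... | no ¬Qz | inj₂ (y , y∈ , Qy , max) =
    inj₂ (y , there y∈ , Qy , λ { (here refl) Qz → ⊥-elim (¬Qz Qz) ; (there x∈) → max x∈ })
  ... | yes Qz | inj₁ none =
    inj₂ (z , here refl , Qz , λ { (here refl) _ → ℕₚ.≤-refl ; (there x∈) Qx → ⊥-elim (none x∈ Qx) })
  ... | yes Qz | inj₂ (y , y∈ , Qy , max) with ℕₚ.≤-total (μ y) (μ z)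
  ...   | inj₁ y≤z = inj₂ (z , here refl , Qz ,
          λ { (here refl) _ → ℕₚ.≤-refl ; (there x∈) Qx → ℕₚ.≤-trans (max x∈ Qx) y≤z })
  ...   | inj₂ z≤y = inj₂ (y , there y∈ , Qy , λ { (here refl) _ → z≤y ; (there x∈) → max x∈ })

  argmaxes : ∀ {C : Set} {Q : C → K → Set} → (∀ c x → Dec (Q c x)) → (μ : C → K → ℕ) (cs : List C) (xs : List K) →
    Σ (List K) λ ys → (∀ {y} → y ∈ ys → y ∈ xs) × length ys ≤ length cs ×
      (∀ {c x} → c ∈ cs → x ∈ xs → Q c x → Σ K λ y → y ∈ ys × Q c y × μ c x ≤ μ c y)
  argmaxes Q? μ [] xs = [] , (λ ()) , z≤n , λ ()
  argmaxes Q? μ (c ∷ cs) xs with argmax (Q? c) (μ c) xs | argmaxes Q? μ cs xs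
  ... | inj₁ none | ys , ys⊆ , len , max = ys , ys⊆ , ℕₚ.m≤n⇒m≤1+n len ,
    λ { (here refl) x∈ Qx → ⊥-elim (none x∈ Qx) ; (there c∈) → max c∈ }
  ... | inj₂ (z , z∈ , Qz , zmax) | ys , ys⊆ , len , max = z ∷ ys ,
    (λ { (here refl) → z∈ ; (there y∈) → ys⊆ y∈ }) , s≤s len ,
    λ { (here refl) x∈ Qx → z , here refl , Qz , zmax x∈ Qx
      ; (there c∈) x∈ Qx → let y , y∈ , rest = max c∈ x∈ Qx in y , there y∈ , rest }

-- The points (i, a) with i ⊓ (a ∸ 1) = r form a chain for the order "i' ≤ i and a ≤ a'",
-- and a ∸ i is monotone along it.
chain-order : ∀ {m i a i' a'} → 1 ≤ a → 1 ≤ a' → i' ≤ m → i ⊓ (a ∸ 1) ≡ i' ⊓ (a' ∸ 1) →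
  a ℕ.+ (m ∸ i) ≤ a' ℕ.+ (m ∸ i') → i' ≤ i × a ≤ a'
chain-order {m} {i} {suc a} {i'} {suc a'} _ _ i'≤m same μ≤ = i'≤i , s≤s a≤a'
  where
  i'≤i : i' ≤ i
  i'≤i with ℕₚ.≤-<-connex i' i
  ... | inj₁ le = le
  ... | inj₂ i<i' with ℕₚ.⊓-sel i' a'
  ...   | inj₁ eq = ⊥-elim (ℕₚ.<⇒≱ i<i' (ℕₚ.≤-trans (ℕₚ.≤-reflexive (≡.sym (≡.trans same eq))) (ℕₚ.m⊓n≤m i a)))
  ...   | inj₂ eq = ⊥-elim (ℕₚ.<⇒≱ (ℕₚ.+-mono-≤-<
            (s≤s (ℕₚ.≤-trans (ℕₚ.≤-reflexive (≡.sym (≡.trans same eq))) (ℕₚ.m⊓n≤n i a)))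
            (ℕₚ.∸-monoʳ-< i<i' i'≤m)) μ≤)
  a≤a' : a ≤ a'
  a≤a' with ℕₚ.≤-<-connex a a'
  ... | inj₁ le = le
  ... | inj₂ a'<a with ℕₚ.⊓-sel i a
  ...   | inj₂ eq = ⊥-elim (ℕₚ.<⇒≱ a'<a (ℕₚ.≤-trans (ℕₚ.≤-reflexive (≡.trans (≡.sym eq) same)) (ℕₚ.m⊓n≤n i' a')))
  ...   | inj₁ eq = ⊥-elim (ℕₚ.<⇒≱ (ℕₚ.+-mono-<-≤ (s≤s a'<a)
            (ℕₚ.∸-monoʳ-≤ m (ℕₚ.≤-trans (ℕₚ.≤-reflexive (≡.trans (≡.sym eq) same)) (ℕₚ.m⊓n≤m i' a')))) μ≤)

-- This is `height (i , j) (suc m)`, the height in the largest summand that occurs infinitely often.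
width : ℕ → ℕ × ℕ → ℕ
width m (i , j) = (j ⊓ suc m) ∸ i

OnChain : ℕ → ℕ → ℕ × ℕ → Set
OnChain m r k@(i , _) = 1 ≤ width m k × i ⊓ (width m k ∸ 1) ≡ r

1≤width⇒i≤m : ∀ {m} k → 1 ≤ width m k → proj₁ k ≤ m
1≤width⇒i≤m {m} (i , j) 1≤a = ℕₚ.≤-pred (ℕₚ.≤-trans
  (ℕₚ.≰⇒> λ le → ℕₚ.<⇒≢ 1≤a (≡.sym (ℕₚ.m≤n⇒m∸n≡0 le))) (ℕₚ.m⊓n≤n j (suc m)))

-- The two arguments of the minimum r = i ⊓ (width - 1) add up to at most m, so 2r ≤ m. This is the
-- source of ⌊m/2⌋ + 1.
chain-bound : ∀ {m r} k → OnChain m r k → r < m / 2 ℕ.+ 1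
chain-bound {m} {r} k@(i , j) (1≤a , refl) = ℕₚ.≤-trans (s≤s (begin
    r           ≡⟨ m*n/n≡m r 2 ⟨
    r * 2 / 2   ≤⟨ /-monoˡ-≤ 2 2r≤m ⟩
    m / 2       ∎)) (ℕₚ.≤-reflexive (ℕₚ.+-comm 1 (m / 2)))
  where
  open ℕₚ.≤-Reasoning
  a = width m k
  i≤ : i ≤ j ⊓ suc m
  i≤ = ℕₚ.<⇒≤ (ℕₚ.≰⇒> λ le → ℕₚ.<⇒≢ 1≤a (≡.sym (ℕₚ.m≤n⇒m∸n≡0 le)))
  2r≤m : r * 2 ≤ m
  2r≤m = ℕₚ.≤-pred (begin
    suc (r * 2)               ≡⟨ ≡.cong suc (ℕₚ.*-comm r 2) ⟩
    suc (r ℕ.+ (r ℕ.+ 0))     ≡⟨ ≡.cong (λ t → suc (r ℕ.+ t)) (ℕₚ.+-identityʳ r) ⟩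
    suc (r ℕ.+ r)             ≤⟨ s≤s (ℕₚ.+-mono-≤ (ℕₚ.m⊓n≤m i (a ∸ 1)) (ℕₚ.m⊓n≤n i (a ∸ 1))) ⟩
    suc (i ℕ.+ (a ∸ 1))       ≡⟨ ℕₚ.+-suc i (a ∸ 1) ⟨
    i ℕ.+ suc (a ∸ 1)         ≡⟨ ≡.cong (i ℕ.+_) (ℕₚ.m+[n∸m]≡n 1≤a) ⟩
    i ℕ.+ a                   ≡⟨ ℕₚ.m+[n∸m]≡n i≤ ⟩
    j ⊓ suc m                 ≤⟨ ℕₚ.m⊓n≤n j (suc m) ⟩
    suc m                     ∎)

chain-height : ∀ {m n} k k' → n ≤ m → proj₁ k' ≤ proj₁ k → width m k ≤ width m k' →
               height k (suc n) ≤ height k' (suc n)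
chain-height {m} {n} (i , j) (i' , j') n≤m i'≤i a≤a' = ℕₚ.⊓-glb
  (begin
    (j ∸ i) ⊓ (suc n ∸ i)   ≤⟨ ℕₚ.⊓-monoʳ-≤ (j ∸ i) (ℕₚ.∸-monoˡ-≤ i (s≤s n≤m)) ⟩
    (j ∸ i) ⊓ (suc m ∸ i)   ≡⟨ ℕₚ.∸-distribʳ-⊓ i j (suc m) ⟨
    (j ⊓ suc m) ∸ i         ≤⟨ a≤a' ⟩
    (j' ⊓ suc m) ∸ i'       ≤⟨ ℕₚ.∸-monoˡ-≤ i' (ℕₚ.m⊓n≤m j' (suc m)) ⟩
    j' ∸ i'                 ∎)
  (ℕₚ.≤-trans (ℕₚ.m⊓n≤n (j ∸ i) _) (ℕₚ.∸-monoʳ-≤ (suc n) i'≤i))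
  where open ℕₚ.≤-Reasoning

module Selection (lem : LEM) (G : AbelianGroup 0ℓ 0ℓ) (e : ℕ) (e≥1 : 1 ≤ e)
                 (e⋆ : ∀ a → AbelianGroup._≈_ G (_·_ G e a) (AbelianGroup.ε G))
                 {p : ℕ} (pp : Prime p) {np mp : ℕ} (isNp : IsNp G p np) (isMp : IsMp G p mp) where
  open FiniteIndex lem G e e≥1 e⋆ pp

  module _ {K : Set} (key : K → ℕ × ℕ) (xs : List K) where

    Selects : ℕ → Set
    Selects N = Σ (List K) λ ys → (∀ {y} → y ∈ ys → y ∈ xs) × length ys ≤ N ×
      (∀ {x} → x ∈ xs → Dominated (key x) (map key ys))

    select-by-summand : Selects np
    select-by-summand =
      let L , _ , ∣L∣≡np , L⇔ = isNp
          ys , ys⊆ , len , max = argmaxes {Q = λ _ _ → ⊤} (λ _ _ → yes tt) (λ n x → height (key x) (suc n)) L xs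
      in ys , ys⊆ , ℕₚ.≤-trans len (ℕₚ.≤-reflexive ∣L∣≡np) , λ x∈ n inf _ _ →
        let y , y∈ , _ , h≤ = max (proj₂ (L⇔ n) inf) x∈ tt in key y , ∈-map⁺ key y∈ , h≤

    -- For each r one condition of maximal weight is kept. By `chain-order` a larger weight on the
    -- same chain means a smaller i and a larger width, hence a larger height in every relevant
    -- summand.
    select-by-chain : Selects (mp / 2 ℕ.+ 1)
    select-by-chain =
      let ys , ys⊆ , len , max = argmaxes {Q = λ r x → OnChain mp r (key x)} (λ r x → (_ ℕ.≤? _) ×-dec (_ ℕ.≟ r))
            (λ _ x → width mp (key x) ℕ.+ (mp ∸ proj₁ (key x))) (upTo (mp / 2 ℕ.+ 1)) xs
      in ys , ys⊆ , ℕₚ.≤-trans len (ℕₚ.≤-reflexive (Listₚ.length-upTo (mp / 2 ℕ.+ 1))) ,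
        λ {x} x∈ n inf i≤n i<j →
          let n≤m = infinite≤mp inf
              on = ℕₚ.m<n⇒0<n∸m (ℕₚ.⊓-glb i<j (s≤s (ℕₚ.≤-trans i≤n n≤m))) , refl
              y , y∈ , (1≤a' , same) , μ≤ = max (∈-upTo⁺ (chain-bound (key x) on)) x∈ on
              i'≤i , a≤a' = chain-order (proj₁ on) 1≤a' (1≤width⇒i≤m (key y) 1≤a') (≡.sym same) μ≤
          in key y , ∈-map⁺ key y∈ , chain-height (key x) (key y) n≤m i'≤i a≤a'
      where
      infinite≤mp : ∀ {n} → UInfinite G p n → n ≤ mp
      infinite≤mp {n} inf = [ (λ (none , _) → ⊥-elim (none n inf)) , (λ (_ , max) → max n inf) ]′ isMp

    select : Selects (np ⊓ (mp / 2 ℕ.+ 1))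
    select with ℕₚ.⊓-sel np (mp / 2 ℕ.+ 1)
    ... | inj₁ eq = ≡.subst Selects (≡.sym eq) select-by-summand
    ... | inj₂ eq = ≡.subst Selects (≡.sym eq) select-by-chain

-- Breadth of the divisibility conditions in several variables

module Breadth (lem : LEM) (G : AbelianGroup 0ℓ 0ℓ) (e : ℕ) (e≥1 : 1 ≤ e)
               (e⋆ : ∀ a → AbelianGroup._≈_ G (_·_ G e a) (AbelianGroup.ε G))
               {p : ℕ} (pp : Prime p) {np mp : ℕ} (isNp : IsNp G p np) (isMp : IsMp G p mp) where
  open AbelianGroup G renaming (Carrier to A; sym to ≈-sym; trans to ≈-trans; refl to ≈-refl; reflexive to ≈-reflexive)
  open GroupLemmas G
  open Exponent G e e≥1 e⋆
  open FiniteIndex lem G e e≥1 e⋆ pp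
  open Selection lem G e e≥1 e⋆ pp isNp isMp

  Condition : ℕ → Set
  Condition l = ℕ × Vec ℕ l

  Holds : ∀ {l} → Condition l → Vector A l → Set
  Holds (j , c) w = Dv p j (dot c w)

  On : ∀ {l} {K : Set} → (K → Condition l) → List K → Vector A l → Vector A l → Set
  On f xs u v = ∀ {x} → x ∈ xs → Holds (f x) (u ⊖ v)

  On-euclidean : ∀ {l} {K : Set} (f : K → Condition l) xs → Euclidean (On f xs)
  On-euclidean f xs {u} {v} {w} uv uw {x} x∈ = Dv-resp
    (≈-trans (-‿cong (dot-⊖ c u w) (dot-⊖ c u v)) (≈-trans
      (solve (dot c u ∷ dot c v ∷ dot c w ∷ []) ((v₀ :- v₂) :- (v₀ :- v₁)) (v₁ :- v₂) refl)
      (≈-sym (dot-⊖ c v w))))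
    (Dv-sub (uw x∈) (uv x∈))
    where
    c = proj₂ (f x)

  monic : ∀ {l} → ℕ → Vec ℕ l → Vector A (suc l) → A
  monic i c w = p ^ i ⋆ w zero ∙ dot c (w ∘ suc)

  -- Multiplying by an inverse of the unit part of the first coefficient modulo pʲ makes that
  -- coefficient a power pⁱ; a coefficient acting as 0 modulo pʲ is replaced by pʲ itself, whence i
  -- ≤ j.
  record Normal {l} (κ : Condition (suc l)) : Set where
    field
      i     : ℕ
      c     : Vec ℕ l
      i≤j   : i ≤ proj₁ κ
      to    : ∀ w → Holds κ w → Dv p (proj₁ κ) (monic i c w)
      from  : ∀ w → Dv p (proj₁ κ) (monic i c w) → Holds κ w

  normal-inessential : ∀ {l j k} {c : Vec ℕ l} → (∀ z → Dv p j (k ⋆ z)) → Normal (j , k ∷ c)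
  normal-inessential {j = j} {k} {c} D = record
    { i = j ; c = c ; i≤j = ℕₚ.≤-refl
    ; to = λ w h → Dv-∙ (Dv-multiple p j (w zero)) (Dv-resp
        (solve (k ⋆ w zero ∷ dot c (w ∘ suc) ∷ []) (v₀ :+ v₁ :- v₀) v₁ refl) (Dv-sub h (D (w zero))))
    ; from = λ w h → Dv-∙ (D (w zero)) (Dv-resp
        (solve (p ^ j ⋆ w zero ∷ dot c (w ∘ suc) ∷ []) (v₀ :+ v₁ :- v₀) v₁ refl)
        (Dv-sub h (Dv-multiple p j (w zero)))) }

  ⋆-valuation : ∀ {k} i u → k ≡ p ^ i * u → ∀ z → k ⋆ z ≈ u ⋆ p ^ i ⋆ z
  ⋆-valuation i u k≡ z =
    ≈-trans (⋆-congˡ (≡.trans k≡ (ℕₚ.*-comm (p ^ i) u))) (⋆-* u (p ^ i) z)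

  normal-essential : ∀ {l j k} i u (c : Vec ℕ l) → k ≡ p ^ i * u → ¬ (p ∣ u) → i ≤ j → Normal (j , k ∷ c)
  normal-essential {l} {j} {k} i u c k≡ p∤u i≤j = record
    { i = i ; c = Vec.map (u' *_) c ; i≤j = i≤j
    ; to = λ w h → Dv-resp (to-eq w) (Dv-sub (Dv-⋆ u' h) (inv (p ^ i ⋆ w zero)))
    ; from = λ w h → Dv-resp (from-eq w) (Dv-sub (Dv-⋆ u h) (inv (dot c (w ∘ suc)))) }
    where
    u' : ℕ
    u' = proj₁ (inverse-mod pp p∤u j)
    inv : ∀ x → Dv p j (u' ⋆ u ⋆ x - x)
    inv = proj₂ (inverse-mod pp p∤u j)
    to-eq : ∀ w → u' ⋆ (k ⋆ w zero ∙ dot c (w ∘ suc)) - (u' ⋆ u ⋆ p ^ i ⋆ w zero - p ^ i ⋆ w zero)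
                  ≈ p ^ i ⋆ w zero ∙ dot (Vec.map (u' *_) c) (w ∘ suc)
    to-eq w = ≈-trans (∙-congʳ (≈-trans (⋆-∙ u' _ _) (∙-congʳ (⋆-cong u' (⋆-valuation i u k≡ (w zero))))))
      (≈-trans (solve (u' ⋆ u ⋆ p ^ i ⋆ w zero ∷ u' ⋆ dot c (w ∘ suc) ∷ p ^ i ⋆ w zero ∷ [])
                      (v₀ :+ v₁ :- (v₀ :- v₂)) (v₂ :+ v₁) refl)
               (∙-congˡ (≈-sym (dot-map-* u' c (w ∘ suc)))))
    from-eq : ∀ w → u ⋆ (p ^ i ⋆ w zero ∙ dot (Vec.map (u' *_) c) (w ∘ suc)) -
                    (u' ⋆ u ⋆ dot c (w ∘ suc) - dot c (w ∘ suc)) ≈ k ⋆ w zero ∙ dot c (w ∘ suc)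
    from-eq w = ≈-trans
      (∙-congʳ (≈-trans (⋆-∙ u _ _) (∙-cong (≈-sym (⋆-valuation i u k≡ (w zero)))
        (≈-trans (⋆-cong u (dot-map-* u' c (w ∘ suc))) (⋆-comm u u' _)))))
      (solve (k ⋆ w zero ∷ u' ⋆ u ⋆ dot c (w ∘ suc) ∷ dot c (w ∘ suc) ∷ [])
             (v₀ :+ v₁ :- (v₁ :- v₂)) (v₀ :+ v₂) refl)

  normalise : ∀ {l} (κ : Condition (suc l)) → Normal κ
  normalise (j , zero ∷ c) = normal-inessential λ _ → Dv-ε
  normalise (j , suc k ∷ c) with valuation pp (suc k) (s≤s z≤n)
  ... | i , u , k≡ , p∤u with ℕₚ.≤-total j i
  ...   | inj₁ j≤i = normal-inessential λ z →
            Dv-resp (≈-sym (⋆-valuation i u k≡ z)) (Dv-⋆ u (Dv-≤ j≤i (Dv-multiple p i z)))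
  ...   | inj₂ i≤j = normal-essential i u c k≡ p∤u i≤j

  monic-⊖ : ∀ {l} i (c : Vec ℕ l) u v → monic i c u - monic i c v ≈ monic i c (u ⊖ v)
  monic-⊖ i c u v = ≈-trans (-‿interchange _ _ _ _)
    (∙-cong (≈-sym (⋆-sub (p ^ i) _ _)) (≈-sym (dot-⊖ c _ _)))

  ⋆-monic : ∀ {l m i} → i ≤ m → ∀ (c : Vec ℕ l) w →
    p ^ (m ∸ i) ⋆ monic i c w ≈ p ^ m ⋆ w zero ∙ p ^ (m ∸ i) ⋆ dot c (w ∘ suc)
  ⋆-monic {m = m} {i} i≤m c w = ≈-trans (⋆-∙ (p ^ (m ∸ i)) _ _) (∙-congʳ
    (≈-trans (≈-sym (^-⋆-+ p (m ∸ i) i _)) (⋆-congˡ (≡.cong (p ^_) (ℕₚ.m∸n+n≡m i≤m)))))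

  shifted-bound : ∀ {m i j b} → i ≤ m → i ≤ j → b ≤ j ∸ i → m ℕ.+ b ≤ m ∸ i ℕ.+ j
  shifted-bound {m} {i} {j} {b} i≤m i≤j b≤ = begin
    m ℕ.+ b                     ≤⟨ ℕₚ.+-monoʳ-≤ m b≤ ⟩
    m ℕ.+ (j ∸ i)               ≡⟨ ≡.cong (ℕ._+ (j ∸ i)) (ℕₚ.m∸n+n≡m i≤m) ⟨
    m ∸ i ℕ.+ i ℕ.+ (j ∸ i)     ≡⟨ ℕₚ.+-assoc (m ∸ i) i _ ⟩
    m ∸ i ℕ.+ (i ℕ.+ (j ∸ i))   ≡⟨ ≡.cong (m ∸ i ℕ.+_) (ℕₚ.m+[n∸m]≡n i≤j) ⟩
    m ∸ i ℕ.+ j                 ∎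
    where open ℕₚ.≤-Reasoning

  -- Conditions are indexed by a type `K`, so that a condition derived in fewer variables remembers
  -- those it came from.
  Narrow : ∀ {l} {K : Set} → (K → Condition l) → List K → Set
  Narrow {l} {K} f xs = Σ (List K) λ ys → (∀ {y} → y ∈ ys → y ∈ xs) × length ys ≤ (np ⊓ (mp / 2 ℕ.+ 1)) * l ×
    Σ ℕ λ N → FI N (On f ys) (On f xs)

  module AddVariable {l} (narrowₗ : ∀ {K : Set} (f : K → Condition l) xs → Narrow f xs)
                     {K : Set} (f : K → Condition (suc l)) (xs : List K) where
    ν : ∀ x → Normal (f x)
    ν x = normalise (f x)
    ι : K → ℕ
    ι x = Normal.i (ν x)
    γ : K → Vec ℕ l
    γ x = Normal.c (ν x)
    j : K → ℕ
    j x = proj₁ (f x)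
    ι≤j : ∀ x → ι x ≤ j x
    ι≤j x = Normal.i≤j (ν x)
    ν-to : ∀ x w → Holds (f x) w → Dv p (j x) (monic (ι x) (γ x) w)
    ν-to x = Normal.to (ν x)
    ν-from : ∀ x w → Dv p (j x) (monic (ι x) (γ x) w) → Holds (f x) w
    ν-from x = Normal.from (ν x)
    key : K → ℕ × ℕ
    key x = ι x , j x
    ys₁ : List K
    ys₁ = proj₁ (select key xs)
    ys₁⊆xs : ∀ {y} → y ∈ ys₁ → y ∈ xs
    ys₁⊆xs = proj₁ (proj₂ (select key xs))
    dominated : ∀ {x} → x ∈ xs → Dominated (key x) (map key ys₁)
    dominated = proj₂ (proj₂ (proj₂ (select key xs)))
    rs : List (ℕ × ℕ)
    rs = map key ys₁

    m : K → K → ℕ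
    m x r = ι x ⊔ ι r

    -- The conditions on the remaining coordinates that are implied by pairs of conditions on all of them.
    K' : Set
    K' = K ⊎ (K × K)
    f' : K' → Condition l
    f' (inj₁ x) = ι x , γ x
    f' (inj₂ (r , x)) = I (key x) (key r) ℕ.+ J (key x) (key r) ,
      Vec.map (p ^ (m x r ∸ ι r) *_) (γ r) ⊸ Vec.map (p ^ (m x r ∸ ι x) *_) (γ x)
    xs' : List K'
    xs' = map inj₁ xs ++ map inj₂ (cartesianProduct ys₁ xs)
    IH : Narrow f' xs'
    IH = narrowₗ f' xs'
    ys' : List K'
    ys' = proj₁ IH

    -- An eliminant of r and x is charged to x alone, because the pivots r in `ys₁` are kept anyway.
    -- So each derived condition selected by the induction costs one original, and d + d·l of them
    -- suffice.
    origin : K' → K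
    origin (inj₁ x) = x
    origin (inj₂ (_ , x)) = x

    origin∈ : ∀ {y} → y ∈ xs' → origin y ∈ xs
    origin∈ y∈ with ∈-++⁻ (map inj₁ xs) y∈
    ... | inj₁ y∈₁ with _ , x∈ , refl ← ∈-map⁻ inj₁ y∈₁ = x∈
    ... | inj₂ y∈₂ with _ , rx∈ , refl ← ∈-map⁻ inj₂ y∈₂ = proj₂ (∈-cartesianProduct⁻ ys₁ xs rx∈)

    pivot∈ : ∀ {r x} → inj₂ (r , x) ∈ xs' → r ∈ ys₁
    pivot∈ y∈ with ∈-++⁻ (map inj₁ xs) y∈
    ... | inj₁ y∈₁ with _ , _ , () ← ∈-map⁻ inj₁ y∈₁
    ... | inj₂ y∈₂ with _ , rx∈ , refl ← ∈-map⁻ inj₂ y∈₂ = proj₁ (∈-cartesianProduct⁻ ys₁ xs rx∈)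

    ys : List K
    ys = ys₁ ++ map origin ys'

    ys⊆xs : ∀ {y} → y ∈ ys → y ∈ xs
    ys⊆xs y∈ with ∈-++⁻ ys₁ y∈
    ... | inj₁ y∈₁ = ys₁⊆xs y∈₁
    ... | inj₂ y∈₂ with _ , y'∈ , refl ← ∈-map⁻ origin y∈₂ = origin∈ (proj₁ (proj₂ IH) y'∈)

    length≤ : length ys ≤ (np ⊓ (mp / 2 ℕ.+ 1)) * suc l
    length≤ = begin
      length ys                               ≡⟨ Listₚ.length-++ ys₁ ⟩
      length ys₁ ℕ.+ length (map origin ys')  ≡⟨ ≡.cong (length ys₁ ℕ.+_) (Listₚ.length-map origin ys') ⟩
      length ys₁ ℕ.+ length ys'               ≤⟨ ℕₚ.+-mono-≤ (proj₁ (proj₂ (proj₂ (select key xs)))) (proj₁ (proj₂ (proj₂ IH))) ⟩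
      d ℕ.+ d * l                             ≡⟨ ℕₚ.*-suc d l ⟨
      d * suc l                               ∎
      where
      open ℕₚ.≤-Reasoning
      d = np ⊓ (mp / 2 ℕ.+ 1)

    shift : ∀ r x {b} w → m x r ℕ.+ b ≤ m x r ∸ ι r ℕ.+ j r → Holds (f r) w →
            Dv p (m x r ℕ.+ b) (p ^ (m x r ∸ ι r) ⋆ monic (ι r) (γ r) w)
    shift r x w le h = Dv-≤ le (Dv-shift (m x r ∸ ι r) (ν-to r w h))

    eliminant : ∀ r x w → dot (proj₂ (f' (inj₂ (r , x)))) (w ∘ suc) ≈
      p ^ (m x r ∸ ι r) ⋆ monic (ι r) (γ r) w - p ^ (m x r ∸ ι x) ⋆ monic (ι x) (γ x) w
    eliminant r x w = ≈-trans (dot-⊸ (Vec.map (p ^ (m x r ∸ ι r) *_) (γ r)) _ (w ∘ suc))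
      (≈-trans (-‿cong (dot-map-* (p ^ (m x r ∸ ι r)) (γ r) _) (dot-map-* (p ^ (m x r ∸ ι x)) (γ x) _))
      (≈-trans (solve (t r ∷ t x ∷ p ^ m x r ⋆ w zero ∷ []) (v₀ :- v₁) ((v₂ :+ v₀) :- (v₂ :+ v₁)) refl)
        (≈-sym (-‿cong (⋆-monic (ℕₚ.m≤n⊔m (ι x) (ι r)) (γ r) w) (⋆-monic (ℕₚ.m≤m⊔n (ι x) (ι r)) (γ x) w)))))
      where
      t : K → A
      t y = p ^ (m x r ∸ ι y) ⋆ dot (γ y) (w ∘ suc)

    tail-Dv : ∀ x w → Dv p (ι x) (monic (ι x) (γ x) w) → Dv p (ι x) (dot (γ x) (w ∘ suc))
    tail-Dv x w h = Dv-resp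
      (solve (p ^ ι x ⋆ w zero ∷ dot (γ x) (w ∘ suc) ∷ []) (v₀ :+ v₁ :- v₀) v₁ refl)
      (Dv-sub h (Dv-multiple p (ι x) (w zero)))

    pivot-bound : ∀ r x → m x r ℕ.+ J (key x) (key r) ≤ m x r ∸ ι r ℕ.+ j r
    pivot-bound r x = shifted-bound (ℕₚ.m≤n⊔m (ι x) (ι r)) (ι≤j r) (ℕₚ.m⊓n≤n (j x ∸ ι x) _)

    On⇒On' : ∀ {u v} → On f ys u v → On f' ys' (u ∘ suc) (v ∘ suc)
    On⇒On' {u} {v} on {inj₁ x} y∈ = tail-Dv x (u ⊖ v)
      (Dv-≤ (ι≤j x) (ν-to x (u ⊖ v) (on (∈-++⁺ʳ ys₁ (∈-map⁺ origin y∈)))))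
    On⇒On' {u} {v} on {inj₂ (r , x)} y∈ = Dv-resp (≈-sym (eliminant r x (u ⊖ v))) (Dv-sub
      (shift r x (u ⊖ v) (pivot-bound r x) (on (∈-++⁺ˡ (pivot∈ (proj₁ (proj₂ IH) y∈)))))
      (Dv-≤ (shifted-bound (ℕₚ.m≤m⊔n (ι x) (ι r)) (ι≤j x) (ℕₚ.m⊓n≤m (j x ∸ ι x) _))
        (Dv-shift (m x r ∸ ι x) (ν-to x (u ⊖ v) (on (∈-++⁺ʳ ys₁ (∈-map⁺ origin y∈)))))))

    -- The derived condition of x gives pⁱ ∣ w for the value w of its monic form, and the eliminant
    -- with a pivot, together with that pivot, gives the condition on the sum of the two subgroups.
    -- So w is in `Sums` and `Gap.gap` applies.
    close : ∀ {x} → x ∈ xs →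
      Σ ℕ λ N → FI N (λ u v → On f ys u v × On f' xs' (u ∘ suc) (v ∘ suc)) (λ u v → Holds (f x) (u ⊖ v))
    close {x} x∈ = let N , fi = Gap.gap (ι≤j x) (dominated x∈) in
      N , FI-mono sums (λ {u} {v} D → ν-from x (u ⊖ v) (Dv-resp (monic-⊖ (ι x) (γ x) u v) D))
                  (FI-on (monic (ι x) (γ x)) fi)
      where
      sums : ∀ {u v} → On f ys u v × On f' xs' (u ∘ suc) (v ∘ suc) →
             Diff (Sums (key x) rs) (monic (ι x) (γ x) u) (monic (ι x) (γ x) v)
      sums {u} {v} (on , on') = resp (Dv-∙ (Dv-multiple p (ι x) _) (on' (∈-++⁺ˡ (∈-map⁺ inj₁ x∈)))) , pairwise
        where
        w = u ⊖ v
        resp : ∀ {k} → Dv p k (monic (ι x) (γ x) w) → Dv p k (monic (ι x) (γ x) u - monic (ι x) (γ x) v)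
        resp = Dv-resp (≈-sym (monic-⊖ (ι x) (γ x) u v))
        pairwise : ∀ {k} → k ∈ rs → Dv p (I (key x) k ℕ.+ J (key x) k)
          (p ^ (I (key x) k ∸ ι x) ⋆ (monic (ι x) (γ x) u - monic (ι x) (γ x) v))
        pairwise k∈ with r , r∈ , refl ← ∈-map⁻ key k∈ = Dv-resp
          (≈-trans (-‿cong ≈-refl (eliminant r x w)) (≈-trans
            (solve (p ^ (m x r ∸ ι r) ⋆ monic (ι r) (γ r) w ∷ p ^ (m x r ∸ ι x) ⋆ monic (ι x) (γ x) w ∷ [])
                   (v₀ :- (v₀ :- v₁)) v₁ refl)
            (⋆-cong (p ^ (m x r ∸ ι x)) (≈-sym (monic-⊖ (ι x) (γ x) u v)))))
          (Dv-sub (shift r x w (pivot-bound r x) (on (∈-++⁺ˡ r∈)))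
                  (on' (∈-++⁺ʳ (map inj₁ xs) (∈-map⁺ inj₂ (∈-cartesianProduct⁺ r∈ x∈)))))

    -- The tower: `ys` implies the derived conditions in `ys'`, these imply all derived conditions
    -- up to finite index by induction, and `close` recovers each condition in `xs`.
    narrow : Narrow f xs
    narrow = ys , ys⊆xs , length≤ , _ ,
      FI-trans lem (On-euclidean f ys) (FI-mono On⇒On' (λ h → h) (FI-on (_∘ suc) (proj₂ (proj₂ (proj₂ (proj₂ IH))))))
               (proj₂ (FI-All xs λ x∈ → close x∈))

  breadth : ∀ l {K : Set} (f : K → Condition l) (xs : List K) → Narrow f xs
  breadth zero f xs = [] , (λ ()) , z≤n , 1 , (λ _ _ → zero) , λ _ _ _ _ _ _ {x} _ → trivial (f x)
    where
    trivial : (κ : Condition zero) → ∀ {w} → Holds κ w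
    trivial (j , []) = Dv-ε
  breadth (suc l) f xs = AddVariable.narrow (breadth l) f xs

-- Counting traces

FI-≤ : ∀ {X : Set} {N M} {R V : X → X → Set} → N ≤ M → FI N R V → FI M R V
FI-≤ N≤M (col , sound) = (λ u₀ u → Fin.inject≤ (col u₀ u) N≤M) ,
  λ u₀ u v Ru Rv eq → sound u₀ u v Ru Rv (Finₚ.inject≤-injective N≤M N≤M _ _ eq)

join-injective : ∀ {m n} (x y : Fin m ⊎ Fin n) → Fin.join m n x ≡ Fin.join m n y → x ≡ y
join-injective {m} {n} x y eq =
  ≡.trans (≡.sym (Finₚ.splitAt-join m n x)) (≡.trans (≡.cong (Fin.splitAt m) eq) (Finₚ.splitAt-join m n y))

sum-zeros : ∀ (f : ℕ → ℕ) xs → (∀ {x} → x ∈ xs → f x ≡ 0) → sum (map f xs) ≡ 0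
sum-zeros f [] z = refl
sum-zeros f (x ∷ xs) z = ≡.cong₂ ℕ._+_ (z (here refl)) (sum-zeros f xs (z ∘ there))

module Counting (lem : LEM) (G : AbelianGroup 0ℓ 0ℓ) (e : ℕ) (e≥1 : 1 ≤ e)
                (e⋆ : ∀ a → AbelianGroup._≈_ G (_·_ G e a) (AbelianGroup.ε G))
                (np mp : ℕ → ℕ) (isNp : ∀ p → Prime p → IsNp G p (np p))
                (isMp : ∀ p → Prime p → IsMp G p (mp p)) where
  open AbelianGroup G renaming (Carrier to A; sym to ≈-sym; trans to ≈-trans; refl to ≈-refl; reflexive to ≈-reflexive)
  open GroupLemmas G
  open Exponent G e e≥1 e⋆
  open Classical lem
  open Elimination lem G e e≥1 e⋆

  Cond : ℕ → Set
  Cond l = ℕ × (ℕ × Vec ℕ l)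

  Holdsₚ : ∀ {l} → Cond l → Vector A l → Set
  Holdsₚ (p , j , c) w = Dv p j (dot c w)

  Onₚ : ∀ {l} → List (Cond l) → Vector A l → Vector A l → Set
  Onₚ xs u v = ∀ {x} → x ∈ xs → Holdsₚ x (u ⊖ v)

  breadth-primes : ∀ {l} (ps : List ℕ) → (∀ {p} → p ∈ ps → Prime p) → (xs : List (Cond l)) →
    Σ (List (Cond l)) λ ys → (∀ {y} → y ∈ ys → y ∈ xs) × length ys ≤ sum (map (dTerm G np mp) ps) * l ×
      Σ ℕ λ N → FI N (Onₚ ys) (λ u v → ∀ {x} → x ∈ xs → proj₁ x ∈ ps → Holdsₚ x (u ⊖ v))
  breadth-primes [] _ xs = [] , (λ ()) , z≤n , 1 , (λ _ _ → zero) , λ _ _ _ _ _ _ _ ()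
  breadth-primes {l} (p ∷ ps) prime xs
    with Breadth.breadth lem G e e≥1 e⋆ (prime (here refl)) (isNp p (prime (here refl))) (isMp p (prime (here refl)))
           l proj₂ (filter (λ x → proj₁ x ℕ.≟ p) xs)
       | breadth-primes ps (prime ∘ there) xs
  ... | ys₁ , ys₁⊆ , len₁ , N₁ , fi₁ | ys₂ , ys₂⊆ , len₂ , N₂ , fi₂ =
    ys₁ ++ ys₂ ,
    (λ y∈ → [ (λ y∈₁ → proj₁ (∈-filter⁻ at-p? {xs = xs} (ys₁⊆ y∈₁))) , ys₂⊆ ]′ (∈-++⁻ ys₁ y∈)) ,
    length≤ , N₁ * N₂ ,
    FI-mono (λ h → h)
      (λ { (h₁ , h₂) x∈ (here refl) → h₁ (∈-filter⁺ at-p? x∈ refl)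
         ; (h₁ , h₂) x∈ (there p∈) → h₂ x∈ p∈ })
      (FI-× {V = λ u v → ∀ {x} → x ∈ filter at-p? xs → Holdsₚ′ x (u ⊖ v)}
            {V' = λ u v → ∀ {x} → x ∈ xs → proj₁ x ∈ ps → Holdsₚ x (u ⊖ v)}
        (FI-mono {R = λ u v → ∀ {x} → x ∈ ys₁ → Holdsₚ′ x (u ⊖ v)}
          (λ on {y} y∈ → at-p y (proj₂ (∈-filter⁻ at-p? {xs = xs} (ys₁⊆ y∈))) (on (∈-++⁺ˡ y∈))) (λ h → h) fi₁)
        (FI-mono {R = Onₚ ys₂} (λ on y∈ → on (∈-++⁺ʳ ys₁ y∈)) (λ h → h) fi₂))
    where
    at-p? : (x : Cond l) → Dec (proj₁ x ≡ p)
    at-p? x = proj₁ x ℕ.≟ p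
    -- The prime stored in the condition is read as `p`; on the filtered list this changes nothing,
    -- and it has the form that `Breadth.breadth` produces.
    Holdsₚ′ : Cond l → Vector A l → Set
    Holdsₚ′ (_ , j , c) w = Dv p j (dot c w)
    at-p : ∀ (x : Cond l) → proj₁ x ≡ p → ∀ {w} → Holdsₚ x w → Holdsₚ′ x w
    at-p x refl h = h
    length≤ : length (ys₁ ++ ys₂) ≤ sum (map (dTerm G np mp) (p ∷ ps)) * l
    length≤ = begin
      length (ys₁ ++ ys₂)                                                ≡⟨ Listₚ.length-++ ys₁ ⟩
      length ys₁ ℕ.+ length ys₂                                          ≤⟨ ℕₚ.+-mono-≤ len₁ len₂ ⟩
      dTerm G np mp p * l ℕ.+ sum (map (dTerm G np mp) ps) * l           ≡⟨ ℕₚ.*-distribʳ-+ l (dTerm G np mp p) _ ⟨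
      (dTerm G np mp p ℕ.+ sum (map (dTerm G np mp) ps)) * l             ∎
      where open ℕₚ.≤-Reasoning

  module Traces {l : ℕ} (ps : List ℕ) (prime : ∀ {p} → p ∈ ps → Prime p) where
    D : ℕ
    D = sum (map (dTerm G np mp) ps) * l

    module _ {n : ℕ} (α : Fin n → A) where
      -- `α` will list the values of linear forms at the points of S; each value cuts out one coset
      -- of {y : pʲ ∣ c·y}, or the empty set.
      At : Cond l → Vector A l → Fin n → Set
      At (p , j , c) b a = Dv p j (α a ∙ dot c b)

      Agree : Cond l → Vector A l → Vector A l → Set
      Agree x b b' = ∀ a → At x b a → At x b' a

      Meets : List (Cond l) → Vector A l → Vector A l → Set
      Meets xs _ b = ∀ {x} → x ∈ xs → Σ (Fin n) (At x b)

      At⇒Holds : ∀ x {b b' a} → At x b a → At x b' a → Holdsₚ x (b ⊖ b')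
      At⇒Holds (p , j , c) {b} {b'} {a} h h' = Dv-resp
        (≈-trans (solve (α a ∷ dot c b ∷ dot c b' ∷ []) (v₀ :+ v₁ :- (v₀ :+ v₂)) (v₁ :- v₂) refl)
                 (≈-sym (dot-⊖ c b b')))
        (Dv-sub h h')

      Holds⇒Agree : ∀ x {b b'} → Holdsₚ x (b ⊖ b') → Agree x b b'
      Holds⇒Agree (p , j , c) {b} {b'} h a Dₐ = Dv-resp
        (≈-trans (-‿cong ≈-refl (dot-⊖ c b b'))
          (solve (α a ∷ dot c b ∷ dot c b' ∷ []) (v₀ :+ v₁ :- (v₁ :- v₂)) (v₀ :+ v₂) refl))
        (Dv-sub Dₐ h)

      -- Each condition is coloured by the index of a coset containing b, which leaves n
      -- possibilities per condition.
      cosets : Fin n → ∀ ys → FI (n ^ length ys) (Meets ys) (Onₚ ys)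
      cosets a₀ [] = (λ _ _ → zero) , λ { _ _ _ _ _ _ () }
      cosets a₀ (y ∷ ys) = FI-mono (λ h → h)
        (λ { (h₁ , h₂) (here refl) → h₁ ; (h₁ , h₂) (there y∈) → h₂ y∈ })
        (FI-× {V' = Onₚ ys} single
          (FI-mono {R = Meets ys} (λ meets y∈ → meets (there y∈)) (λ h → h) (cosets a₀ ys)))
        where
        single : FI n (Meets (y ∷ ys)) (λ b b' → Holdsₚ y (b ⊖ b'))
        single = (λ _ b → choose (At y b) a₀) , λ _ b b' meets meets' eq →
          At⇒Holds y (≡.subst (At y b) eq (choose-correct (At y b) a₀ (meets (here refl))))
                     (choose-correct (At y b') a₀ (meets' (here refl)))

    -- The profile of b is the list of those conditions x for which b lies in one of the n cosets.
    -- There are boundedly many profiles, and on each of them at most D of these cosets determine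
    -- the others up to finitely many possibilities.
    profiles : ∀ xs ks → (∀ {x} → x ∈ xs ⊎ x ∈ ks → proj₁ x ∈ ps) → Σ ℕ λ C →
      ∀ {n} (α : Fin n → A) → Fin n →
      FI (C * n ^ D) (Meets α xs) (λ b b' → ∀ {x} → x ∈ xs ⊎ x ∈ ks → Agree α x b b')
    profiles xs [] in-ps with breadth-primes ps prime xs
    ... | ys , ys⊆ , len , N , fi = N , λ {n} α a₀ →
      FI-≤ (ℕₚ.≤-trans (ℕₚ.≤-reflexive (ℕₚ.*-comm (n ^ length ys) N))
             (ℕₚ.*-monoʳ-≤ N (ℕₚ.^-monoʳ-≤ n {{Finₚ.nonZeroIndex a₀}} len)))
        (FI-trans lem {W = Onₚ ys} (λ _ meets → meets)
          (FI-mono {R = Meets α ys} (λ meets y∈ → meets (ys⊆ y∈)) (λ h → h) (cosets α a₀ ys))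
          (FI-mono {V = λ b b' → ∀ {x} → x ∈ xs → proj₁ x ∈ ps → Holdsₚ x (b ⊖ b')} proj₂ (λ { h {x} (inj₁ x∈) → Holds⇒Agree α x (h x∈ (in-ps (inj₁ x∈))) }) fi))
    -- One recursive call treats the b that meet `k`, the other those that do not; the latter agree
    -- on `k` vacuously.
    profiles xs (k ∷ ks) in-ps
      with profiles (k ∷ xs) ks (λ { (inj₁ (here refl)) → in-ps (inj₂ (here refl))
                                   ; (inj₁ (there x∈)) → in-ps (inj₁ x∈) ; (inj₂ x∈) → in-ps (inj₂ (there x∈)) })
         | profiles xs ks (λ { (inj₁ x∈) → in-ps (inj₁ x∈) ; (inj₂ x∈) → in-ps (inj₂ (there x∈)) })
    ... | C₁ , fi₁ | C₂ , fi₂ = C₁ ℕ.+ C₂ , λ {n} α a₀ →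
      FI-≤ (ℕₚ.≤-reflexive (≡.sym (ℕₚ.*-distribʳ-+ (n ^ D) C₁ C₂))) (glue α (fi₁ α a₀) (fi₂ α a₀))
      where
      glue : ∀ {n N₁ N₂} (α : Fin n → A) →
        FI N₁ (Meets α (k ∷ xs)) (λ b b' → ∀ {x} → x ∈ k ∷ xs ⊎ x ∈ ks → Agree α x b b') →
        FI N₂ (Meets α xs) (λ b b' → ∀ {x} → x ∈ xs ⊎ x ∈ ks → Agree α x b b') →
        FI (N₁ ℕ.+ N₂) (Meets α xs) (λ b b' → ∀ {x} → x ∈ xs ⊎ x ∈ k ∷ ks → Agree α x b b')
      glue {n} {N₁} {N₂} α (col₁ , sound₁) (col₂ , sound₂) =
        (λ u₀ b → Fin.join N₁ N₂ (col u₀ b (lem (Σ (Fin n) (At α k b))))) ,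
        λ u₀ b b' meets meets' eq → sound u₀ b b' meets meets' (lem _) (lem _) (join-injective _ _ eq)
        where
        col : ∀ u₀ b → Σ (Fin n) (At α k b) ⊎ ¬ Σ (Fin n) (At α k b) → Fin N₁ ⊎ Fin N₂
        col u₀ b (inj₁ _) = inj₁ (col₁ u₀ b)
        col u₀ b (inj₂ _) = inj₂ (col₂ u₀ b)
        add : ∀ {b} → Meets α xs b b → Σ (Fin n) (At α k b) → Meets α (k ∷ xs) b b
        add meets kb (here refl) = kb
        add meets kb (there x∈) = meets x∈
        sound : ∀ u₀ b b' → Meets α xs b b → Meets α xs b' b' → ∀ d d' → col u₀ b d ≡ col u₀ b' d' →
          ∀ {x} → x ∈ xs ⊎ x ∈ k ∷ ks → Agree α x b b'
        sound u₀ b b' meets meets' (inj₁ kb) (inj₁ kb') eq x∈ =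
          sound₁ u₀ b b' (add meets kb) (add meets' kb') (inj₁-injective eq) (regroup x∈)
          where
          regroup : ∀ {x} → x ∈ xs ⊎ x ∈ k ∷ ks → x ∈ k ∷ xs ⊎ x ∈ ks
          regroup (inj₁ x∈) = inj₁ (there x∈)
          regroup (inj₂ (here refl)) = inj₁ (here refl)
          regroup (inj₂ (there x∈)) = inj₂ x∈
        sound u₀ b b' meets meets' (inj₂ ¬kb) (inj₂ _) eq (inj₁ x∈) =
          sound₂ u₀ b b' meets meets' (inj₂-injective eq) (inj₁ x∈)
        sound u₀ b b' meets meets' (inj₂ ¬kb) (inj₂ _) eq (inj₂ (here refl)) = λ a h → ⊥-elim (¬kb (a , h))
        sound u₀ b b' meets meets' (inj₂ ¬kb) (inj₂ _) eq (inj₂ (there x∈)) =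
          sound₂ u₀ b b' meets meets' (inj₂-injective eq) (inj₂ x∈)

  dot-++ : ∀ {k l} (c : Vec ℕ k) (d : Vec ℕ l) (x : Vector A k) (b : Vector A l) →
           dot (c Vec.++ d) (x F.++ b) ≈ dot c x ∙ dot d b
  dot-++ [] d x b = ≈-sym (identityˡ _)
  dot-++ {suc k} {l} (n ∷ c) d x b = ≈-trans
    (∙-congˡ (≈-trans (dot-cong (c Vec.++ d) tail-++) (dot-++ c d (x ∘ suc) b)))
    (≈-sym (assoc _ _ _))
    where
    tail-++ : ∀ i → (x F.++ b) (suc i) ≈ ((x ∘ suc) F.++ b) i
    tail-++ i with Fin.splitAt k i
    ... | inj₁ _ = ≈-refl
    ... | inj₂ _ = ≈-refl

  digits : ∀ {n} → Vec ℕ n → Vec ℕ n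
  digits = Vec.map (Fin.toℕ ∘ digit)

  dot-digits : ∀ {n} (c : Vec ℕ n) ρ → dot c ρ ≈ dot (digits c) ρ
  dot-digits [] ρ = ≈-refl
  dot-digits (k ∷ c) ρ = ∙-cong (⋆-digit k (ρ zero)) (dot-digits c (ρ ∘ suc))

  digit-vectors : ∀ n → List (Vec ℕ n)
  digit-vectors zero = [] ∷ []
  digit-vectors (suc n) = cartesianProductWith _∷_ (upTo e) (digit-vectors n)

  digits∈ : ∀ {n} (c : Vec ℕ n) → digits c ∈ digit-vectors n
  digits∈ [] = here refl
  digits∈ (k ∷ c) = ∈-cartesianProductWith⁺ _∷_ (∈-upTo⁺ (Finₚ.toℕ<n (digit k))) (digits∈ c)

  module Bound (P : List ℕ) (prime : ∀ p → p ∈ P → Prime p) (rest : ∀ p → Prime p → p ∉ P → np p ≡ 0) where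

    extra? : ∀ q → Dec (Prime q × q ∉ P)
    extra? q = prime? q ×-dec ¬? (q ∈? P)

    -- A prime outside `P` may divide `e` and give conditions, so it is added; its term in the sum
    -- is 0.
    extra : List ℕ
    extra = filter extra? (upTo (suc e))

    ps : List ℕ
    ps = P ++ extra

    ps-prime : ∀ {p} → p ∈ ps → Prime p
    ps-prime p∈ = [ prime _ , (λ p∈e → proj₁ (proj₂ (∈-filter⁻ extra? {xs = upTo (suc e)} p∈e))) ]′ (∈-++⁻ P p∈)

    ∣e⇒∈ps : ∀ {p} → Prime p → p ∣ e → p ∈ ps
    ∣e⇒∈ps {p} pp p∣e with p ∈? P
    ... | yes p∈ = ∈-++⁺ˡ p∈
    ... | no p∉ = ∈-++⁺ʳ P (∈-filter⁺ extra? (∈-upTo⁺ (s≤s (∣⇒≤ p∣e))) (pp , p∉))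

    sum-ps : sum (map (dTerm G np mp) ps) ≡ sum (map (dTerm G np mp) P)
    sum-ps = begin
      sum (map δ (P ++ extra))                  ≡⟨ ≡.cong sum (Listₚ.map-++ δ P extra) ⟩
      sum (map δ P ++ map δ extra)              ≡⟨ sum-++ (map δ P) (map δ extra) ⟩
      sum (map δ P) ℕ.+ sum (map δ extra)       ≡⟨ ≡.cong (sum (map δ P) ℕ.+_) (sum-zeros δ extra vanish) ⟩
      sum (map δ P) ℕ.+ 0                       ≡⟨ ℕₚ.+-identityʳ _ ⟩
      sum (map δ P)                             ∎
      where
      open ≡.≡-Reasoning
      δ = dTerm G np mp
      vanish : ∀ {q} → q ∈ extra → δ q ≡ 0
      vanish {q} q∈ = let _ , pq , q∉ = ∈-filter⁻ extra? {xs = upTo (suc e)} q∈ in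
        ≡.cong (_⊓ (mp q / 2 ℕ.+ 1)) (rest q pq q∉)

    module _ (k l : ℕ) where
      open Traces {l} ps ps-prime

      -- Exponents beyond `e` and coefficients from `e` on give nothing new, so this finite list
      -- stands for all conditions.
      conditions : List (Cond l)
      conditions = cartesianProduct ps (cartesianProduct (upTo (suc e)) (digit-vectors l))

      E : ℕ
      E = length (digit-vectors k)

      module _ {t : ℕ} (S : Fin t → Vector A k) where

        α : Fin (t * E) → A
        α a = let s , d = Fin.remQuot E a in dot (lookup (digit-vectors k) d) (S s)

        α-onto : ∀ s c → Σ (Fin (t * E)) λ a → α a ≡ dot (digits c) (S s)
        α-onto s c = Fin.combine s d , ≡.trans
          (≡.cong (λ (s , d) → dot (lookup (digit-vectors k) d) (S s)) (Finₚ.remQuot-combine s d))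
          (≡.cong (λ c → dot c (S s)) (≡.sym (lookup-index (digits∈ c))))
          where
          d = index (digits∈ c)

        -- Splitting c into c₁ and c₂ turns pʲ ∣ c·(S s, b) into the statement that b lies in the
        -- coset belonging to the value c₁·S s.
        agree⇒Sim : ∀ {b b'} → (∀ {x} → x ∈ conditions → Agree α x b b') →
          ∀ {p} → Prime p → ∀ s → Sim p (S s F.++ b) (S s F.++ b')
        agree⇒Sim {b} {b'} agree {p} pp s j c D with p ∣? e
        ... | no p∤e = AtPrime.¬p∣e⇒Dv pp p∤e
        ... | yes p∣e with Vec.splitAt k c
        ...   | c₁ , c₂ , refl with α-onto s c₁
        ...     | a , αa≡ = Dv-resp (≈-sym (reduce b')) (AtPrime.Dv-⊓ pp
                    (agree (∈-cartesianProduct⁺ (∣e⇒∈ps pp p∣e) (∈-cartesianProduct⁺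
                             (∈-upTo⁺ (s≤s (ℕₚ.m⊓n≤n j e))) (digits∈ c₂))) a
                           (Dv-≤ (ℕₚ.m⊓n≤m j e) (Dv-resp (reduce b) D))))
          where
          reduce : ∀ x → dot (c₁ Vec.++ c₂) (S s F.++ x) ≈ α a ∙ dot (digits c₂) x
          reduce x = ≈-trans (dot-++ c₁ c₂ (S s) x) (∙-cong
            (≈-trans (dot-digits c₁ (S s)) (≈-reflexive (≡.sym αa≡))) (dot-digits c₂ x))

      few-traces : Σ ℕ λ C → ∀ (φ : Formula (k ℕ.+ l)) {t} → 1 ≤ t → (S : Fin t → Vector A k) →
        ∀ N → C * (t * E) ^ D < N → TracesBelow G φ S N
      few-traces = C , bound
        where
        counted = profiles [] conditions
          λ { (inj₂ x∈) → proj₁ (∈-cartesianProduct⁻ ps (cartesianProduct (upTo (suc e)) (digit-vectors l)) x∈) }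
        C = proj₁ counted
        bound : ∀ (φ : Formula (k ℕ.+ l)) {t} → 1 ≤ t → (S : Fin t → Vector A k) →
          ∀ N → C * (t * E) ^ D < N → TracesBelow G φ S N
        bound φ t≥1 S N big b =
          -- A point of S exists since t ≥ 1; its value under the zero form serves as default coset.
          let a₀ = proj₁ (α-onto S (Fin.fromℕ< t≥1) (Vec.replicate k 0))
              col , sound = proj₂ counted (α S) a₀
              i , j , i<j , eq = Finₚ.pigeonhole big (λ i → col (λ _ → ε) (b i))
              agree : ∀ {x} → x ∈ conditions → Agree (α S) x (b i) (b j)
              agree x∈ = sound (λ _ → ε) (b i) (b j) (λ ()) (λ ()) eq (inj₂ x∈)
              agree' : ∀ {x} → x ∈ conditions → Agree (α S) x (b j) (b i)
              agree' x∈ = sound (λ _ → ε) (b j) (b i) (λ ()) (λ ()) (≡.sym eq) (inj₂ x∈)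
          in i , j , Finₚ.<⇒≢ i<j , λ s →
            Sat-≋ φ (λ pp → agree⇒Sim S agree pp s , agree⇒Sim S agree' pp s) ,
            Sat-≋ φ (λ pp → agree⇒Sim S agree' pp s , agree⇒Sim S agree pp s)

^-distribʳ-* : ∀ m n o → (m * n) ^ o ≡ m ^ o * n ^ o
^-distribʳ-* m n zero = refl
^-distribʳ-* m n (suc o) = ≡.trans (≡.cong (m * n *_) (^-distribʳ-* m n o)) (ℕₚ.[m*n]*[o*p]≡[m*o]*[n*p] m n (m ^ o) (n ^ o))

-- The q-th power of C(tE)ᴰ is (CEᴰ)^q · t^(Dq), and the extra factor t only enlarges the bound.
root-bound : ∀ {C E D q t N} → 1 ≤ t → (C * E ^ D) ^ q * t ^ (D * q ℕ.+ 1) < N ^ q → C * (t * E) ^ D < N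
root-bound {C} {E} {D} {q} {t} {N} t≥1 big = ℕₚ.≰⇒> λ N≤ → ℕₚ.<⇒≱ big (begin
  N ^ q                                   ≤⟨ ℕₚ.^-monoˡ-≤ q N≤ ⟩
  (C * (t * E) ^ D) ^ q                   ≡⟨ ≡.cong (λ x → (C * x) ^ q) (≡.trans (^-distribʳ-* t E D) (ℕₚ.*-comm (t ^ D) (E ^ D))) ⟩
  (C * (E ^ D * t ^ D)) ^ q               ≡⟨ ≡.cong (_^ q) (ℕₚ.*-assoc C (E ^ D) (t ^ D)) ⟨
  (C * E ^ D * t ^ D) ^ q                 ≡⟨ ^-distribʳ-* (C * E ^ D) (t ^ D) q ⟩
  (C * E ^ D) ^ q * (t ^ D) ^ q           ≡⟨ ≡.cong ((C * E ^ D) ^ q *_) (ℕₚ.^-*-assoc t D q) ⟩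
  (C * E ^ D) ^ q * t ^ (D * q)           ≤⟨ ℕₚ.*-monoʳ-≤ ((C * E ^ D) ^ q) (ℕₚ.^-monoʳ-≤ t {{ℕ.>-nonZero t≥1}} (ℕₚ.m≤m+n (D * q) 1)) ⟩
  (C * E ^ D) ^ q * t ^ (D * q ℕ.+ 1)     ∎)
  where open ℕₚ.≤-Reasoning

theorem1p2 : LEM → (G : AbelianGroup 0ℓ 0ℓ) → Infinite G → FiniteExponent G →
    (np mp : ℕ → ℕ) → (∀ p → Prime p → IsNp G p (np p)) → (∀ p → Prime p → IsMp G p (mp p)) →
    (P : List ℕ) → Unique P → (∀ p → p ∈ P → Prime p) → (∀ p → Prime p → p ∉ P → np p ≡ 0) →
    ∀ k l → (φ : Formula (k Data.Nat.+ l)) →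
    VCDensity≤ G k l φ (sum (map (dTerm G np mp) P) * l)
theorem1p2 lem G _ (e , e≥1 , e⋆) np mp isNp isMp P _ prime rest k l φ q _ =
  (C * E k l ^ (d * l)) ^ q , 1 , λ t t≥1 S _ N big →
    bound φ t≥1 S N (≡.subst (λ x → C * (t * E k l) ^ (x * l) < N) (≡.sym sum-ps)
      (root-bound {C} {E k l} {d * l} {q} t≥1 big))
  where
  open Counting lem G e e≥1 e⋆ np mp isNp isMp
  open Bound P prime rest
  d = sum (map (dTerm G np mp) P)
  C = proj₁ (few-traces k l)
  bound = proj₂ (few-traces k l)
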